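{- Let $U$ be a universal prefix-free machine, and let $S$ be an infinite $\Delta^0_2$ subset of $M_U=\{\rho : U(\rho)\downarrow \text{ and } |\rho| = K(U(\rho))\}$. Then $\emptyset'\le_T S$.
   Context: $K$ denotes prefix-free Kolmogorov complexity defined from $U$. $M_U$ is the set of minimal-length $U$-descriptions. -}

module Defs where

open import Data.Nat.Base using (ℕ; zero; suc; _+_; _*_; _^_; _≤_; _<_; ⌊_/2⌋)
open import Data.Bool.Base using (Bool; true; false; if_then_else_)
open import Data.List.Base using (List; []; _∷_; _++_; length)
open import Data.Maybe.Base using (Maybe; just; nothing)
open import Data.Product.Base using (Σ; _×_; _,_; ∃)
open import Relation.Binary.PropositionalEquality using (_≡_)
open import Relation.Nullary.Negation.Core using (¬_)

-- A concrete model of computation: (oracle) partial recursive functions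
-- (Kleene's μ-recursive functions with an extra oracle primitive),
-- with an inductive big-step semantics.

data Code : Set where
  zer  : Code
  sucC : Code
  proj : ℕ → Code
  comp : Code → List Code → Code
  prec : Code → Code → Code
  mu   : Code → Code
  orc  : Code

nth : List ℕ → ℕ → Maybe ℕ
nth []       _       = nothing
nth (x ∷ xs) zero    = just x
nth (x ∷ xs) (suc i) = nth xs i

bit : Bool → ℕ
bit true  = 1
bit false = 0

mutual
  data _⊢_[_]⇓_ (O : ℕ → Bool) : Code → List ℕ → ℕ → Set where
    ev-zer  : ∀ {xs} → O ⊢ zer [ xs ]⇓ 0
    ev-suc  : ∀ {x} → O ⊢ sucC [ x ∷ [] ]⇓ suc x
    ev-proj : ∀ {i xs y} → nth xs i ≡ just y → O ⊢ proj i [ xs ]⇓ y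
    ev-comp : ∀ {f gs xs ys z} → EvalAll O gs xs ys → O ⊢ f [ ys ]⇓ z →
              O ⊢ comp f gs [ xs ]⇓ z
    ev-prec0 : ∀ {f g xs y} → O ⊢ f [ xs ]⇓ y → O ⊢ prec f g [ 0 ∷ xs ]⇓ y
    ev-precS : ∀ {f g n xs y z} → O ⊢ prec f g [ n ∷ xs ]⇓ y →
               O ⊢ g [ n ∷ y ∷ xs ]⇓ z → O ⊢ prec f g [ suc n ∷ xs ]⇓ z
    ev-mu   : ∀ {f xs n} → O ⊢ f [ n ∷ xs ]⇓ 0 →
              (∀ m → m < n → Σ ℕ λ k → O ⊢ f [ m ∷ xs ]⇓ suc k) →
              O ⊢ mu f [ xs ]⇓ n
    ev-orc  : ∀ {x} → O ⊢ orc [ x ∷ [] ]⇓ bit (O x)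

  data EvalAll (O : ℕ → Bool) : List Code → List ℕ → List ℕ → Set where
    ea-[] : ∀ {xs} → EvalAll O [] xs []
    ea-∷  : ∀ {g gs xs y ys} → O ⊢ g [ xs ]⇓ y → EvalAll O gs xs ys →
            EvalAll O (g ∷ gs) xs (y ∷ ys)

∅O : ℕ → Bool
∅O _ = false

-- Binary strings and their standard bijection with ℕ
-- ([] ↦ 0, 0σ ↦ 2⌜σ⌝+1, 1σ ↦ 2⌜σ⌝+2).

Str : Set
Str = List Bool

⌜_⌝ : Str → ℕ
⌜ [] ⌝        = 0
⌜ false ∷ s ⌝ = suc (2 * ⌜ s ⌝)
⌜ true ∷ s ⌝  = suc (suc (2 * ⌜ s ⌝))

odd? : ℕ → Bool
odd? zero          = false
odd? (suc zero)    = true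
odd? (suc (suc n)) = odd? n

-- inverse of ⌜_⌝ (first argument is fuel; fuel n suffices for n)
decodeAux : ℕ → ℕ → Str
decodeAux zero    _       = []
decodeAux (suc f) zero    = []
decodeAux (suc f) (suc m) = odd? m ∷ decodeAux f ⌊ m /2⌋

decode : ℕ → Str
decode n = decodeAux n n

Runs : Code → Str → Str → Set
Runs M ρ τ = ∅O ⊢ M [ ⌜ ρ ⌝ ∷ [] ]⇓ ⌜ τ ⌝

Halts : Code → Str → Set
Halts M ρ = ∃ λ τ → Runs M ρ τ

PrefixFree : Code → Set
PrefixFree M = ∀ ρ σ → Halts M ρ → Halts M (ρ ++ σ) → σ ≡ []

UniversalPF : Code → Set
UniversalPF U = PrefixFree U ×
  (∀ M → PrefixFree M → Σ Str λ σ → ∀ ρ τ →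
     (Runs U (σ ++ ρ) τ → Runs M ρ τ) × (Runs M ρ τ → Runs U (σ ++ ρ) τ))

IsK : Code → Str → ℕ → Set
IsK U τ k = (Σ Str λ ρ → Runs U ρ τ × length ρ ≡ k) ×
            (∀ ρ → Runs U ρ τ → k ≤ length ρ)

InMU : Code → Str → Set
InMU U ρ = Σ Str λ τ → Runs U ρ τ × IsK U τ (length ρ)

SOracle : (Str → Bool) → ℕ → Bool
SOracle S n = S (decode n)

Infinite : (Str → Bool) → Set
Infinite S = ∀ n → Σ Str λ ρ → n ≤ length ρ × S ρ ≡ true

-- R is a total computable relation (output 0 means "holds")
Total3 : Code → Set
Total3 R = ∀ x a b → Σ ℕ λ v → ∅O ⊢ R [ x ∷ a ∷ b ∷ [] ]⇓ v

Σ⁰₂ : (Str → Bool) → Set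
Σ⁰₂ S = Σ Code λ R → Total3 R × (∀ ρ →
  (S ρ ≡ true → Σ ℕ λ a → ∀ b → ∅O ⊢ R [ ⌜ ρ ⌝ ∷ a ∷ b ∷ [] ]⇓ 0) ×
  ((Σ ℕ λ a → ∀ b → ∅O ⊢ R [ ⌜ ρ ⌝ ∷ a ∷ b ∷ [] ]⇓ 0) → S ρ ≡ true))

Π⁰₂ : (Str → Bool) → Set
Π⁰₂ S = Σ Code λ R → Total3 R × (∀ ρ →
  (S ρ ≡ true → ∀ a → Σ ℕ λ b → ∅O ⊢ R [ ⌜ ρ ⌝ ∷ a ∷ b ∷ [] ]⇓ 0) ×
  ((∀ a → Σ ℕ λ b → ∅O ⊢ R [ ⌜ ρ ⌝ ∷ a ∷ b ∷ [] ]⇓ 0) → S ρ ≡ true))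

Δ⁰₂ : (Str → Bool) → Set
Δ⁰₂ S = Σ⁰₂ S × Π⁰₂ S

pair : ℕ → ℕ → ℕ
pair x y = 2 ^ x * suc (2 * y)

mutual
  encode : Code → ℕ
  encode zer        = pair 0 0
  encode sucC       = pair 1 0
  encode (proj i)   = pair 2 i
  encode (comp f gs) = pair 3 (pair (encode f) (encodeL gs))
  encode (prec f g) = pair 4 (pair (encode f) (encode g))
  encode (mu f)     = pair 5 (encode f)
  encode orc        = pair 6 0

  encodeL : List Code → ℕ
  encodeL []       = 0
  encodeL (c ∷ cs) = pair (encode c) (encodeL cs)

Halting : ℕ → Set
Halting n = Σ Code λ e → encode e ≡ n × Σ ℕ λ y → ∅O ⊢ e [ n ∷ [] ]⇓ y

_≤T_ : (ℕ → Set) → (ℕ → Bool) → Set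
A ≤T O = Σ Code λ Φ → ∀ n →
  (A n → O ⊢ Φ [ n ∷ [] ]⇓ 1) × (¬ A n → O ⊢ Φ [ n ∷ [] ]⇓ 0)

{-# OPTIONS --safe #-}

-- Fix computable colourings of the strings by m colours, uniformly in m, such that S
-- meets every colour; they exist because S is Σ⁰₂ and infinite.  To decide whether k
-- belongs to the halting problem, take m = 4 ^ k and search, with the help of S, for
-- a stage s by which U is seen to halt on an element of S of every colour.  Suppose
-- that k enters the halting problem only at a later stage c.  By Kraft's inequality
-- the strings on which U halts by stage c have total weight at most 1, so some colour
-- has weight at most 4 ^ -k among them.  From k, and hence c, the elements of the first
-- such colour can be given a prefix-free code that is 2 k bits shorter than the elements
-- themselves.  Together with k + 1 bits for k this describes U(ρ) for some minimal
-- ρ ∈ S by a string of length |ρ| - k + O(1), which is impossible for large k.  So for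
-- large k it suffices to check whether k has entered by stage s.

module Submission where

open import Defs
open import Level using (0ℓ)
open import Axiom.ExcludedMiddle using (ExcludedMiddle)
open import Data.Bool.Base using (Bool; true; false)
open import Data.Empty using (⊥; ⊥-elim)
open import Data.Fin using (Fin; zero; suc; toℕ; #_)
open import Data.List.Base using (List; []; _∷_; _++_; length)
open import Data.List.Properties using (length-++; ++-identityʳ; ∷-injectiveʳ)
open import Data.Maybe.Base using (just)
open import Data.Nat.Base
open import Data.Nat.Divisibility using (_∣_; divides; ∣m∣n⇒∣m+n; ∣n⇒∣m*n; _∣0)
open import Data.Nat.Induction using (<-rec)
open import Data.Nat.Properties
open import Data.Nat.Tactic.RingSolver using (solve-∀)
open import Data.Product.Base using (Σ; _×_; _,_; ∃; proj₁; proj₂)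
open import Data.Sum.Base using (_⊎_; inj₁; inj₂; [_,_]′)
open import Data.Unit.Base using (⊤; tt)
open import Relation.Binary.Definitions using (tri<; tri≈; tri>)
open import Relation.Binary.PropositionalEquality
open import Relation.Nullary using (¬_; yes; no; does)

-- Minimality makes the elements of `S` incompressible, yet a machine that is to compress one of
-- them must be computable and so cannot ask which strings lie in `S`. The colouring bridges this
-- gap: the machine treats a whole colour class alike, without knowing `S`, and since `S` meets
-- every colour the class is sure to contain an element that must not be compressed. Which colour
-- turns out light is known only when `k` enters, long after the search has stopped; hence the
-- search has to serve all colours in advance. The number of colours balances two costs: a
-- self-delimiting `k` in unary takes about k bits, so the gain per element has to outgrow k. What
-- counts as large is fixed by the length of the prefix under which `U` simulates the machine, and
-- the finitely many smaller `k` go into a table. Excluded middle supplies truth values and case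
-- distinctions but never an algorithm: each computability claim carries an explicit code.

mutual
  ⇓-deterministic : ∀ {O c xs y z} → O ⊢ c [ xs ]⇓ y → O ⊢ c [ xs ]⇓ z → y ≡ z
  ⇓-deterministic ev-zer ev-zer = refl
  ⇓-deterministic ev-suc ev-suc = refl
  ⇓-deterministic (ev-proj p) (ev-proj q) with trans (sym p) q
  ... | refl = refl
  ⇓-deterministic (ev-comp as e) (ev-comp bs e′) with EvalAll-deterministic as bs
  ... | refl = ⇓-deterministic e e′
  ⇓-deterministic (ev-prec0 e) (ev-prec0 e′) = ⇓-deterministic e e′
  ⇓-deterministic (ev-precS e s) (ev-precS e′ s′) with ⇓-deterministic e e′
  ... | refl = ⇓-deterministic s s′
  ⇓-deterministic (ev-mu {n = n} e below) (ev-mu {n = n′} e′ below′) with <-cmp n n′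
  ... | tri≈ _ n≡n′ _ = n≡n′
  ... | tri< n<n′ _ _ with ⇓-deterministic e (proj₂ (below′ n n<n′))
  ...   | ()
  ⇓-deterministic (ev-mu {n = n} e below) (ev-mu {n = n′} e′ below′)
      | tri> _ _ n′<n with ⇓-deterministic (proj₂ (below n′ n′<n)) e′
  ...   | ()
  ⇓-deterministic ev-orc ev-orc = refl

  EvalAll-deterministic : ∀ {O gs xs ys zs} → EvalAll O gs xs ys → EvalAll O gs xs zs → ys ≡ zs
  EvalAll-deterministic ea-[] ea-[] = refl
  EvalAll-deterministic (ea-∷ e es) (ea-∷ e′ es′) =
    cong₂ _∷_ (⇓-deterministic e e′) (EvalAll-deterministic es es′)

⇓-resp-≡ : ∀ {O c xs y z} → y ≡ z → O ⊢ c [ xs ]⇓ y → O ⊢ c [ xs ]⇓ z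
⇓-resp-≡ refl e = e

-- Replacing the empty oracle by an arbitrary one

mutual
  -- A query to the empty oracle is answered by 0, so `zer` can take the place of `orc`, and the
  -- result behaves the same under every oracle. The computable matrix of `S` can thus be evaluated
  -- by procedures that have `S` as their oracle.
  strip : Code → Code
  strip zer         = zer
  strip sucC        = sucC
  strip (proj i)    = proj i
  strip (comp f gs) = comp (strip f) (stripAll gs)
  strip (prec f g)  = prec (strip f) (strip g)
  strip (mu f)      = mu (strip f)
  strip orc         = zer

  stripAll : List Code → List Code
  stripAll []       = []
  stripAll (g ∷ gs) = strip g ∷ stripAll gs

mutual
  strip-⇓ : ∀ {O c xs y} → ∅O ⊢ c [ xs ]⇓ y → O ⊢ strip c [ xs ]⇓ y
  strip-⇓ ev-zer         = ev-zer
  strip-⇓ ev-suc         = ev-suc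
  strip-⇓ (ev-proj p)    = ev-proj p
  strip-⇓ (ev-comp as e) = ev-comp (stripAll-⇓ as) (strip-⇓ e)
  strip-⇓ (ev-prec0 e)   = ev-prec0 (strip-⇓ e)
  strip-⇓ (ev-precS e s) = ev-precS (strip-⇓ e) (strip-⇓ s)
  strip-⇓ (ev-mu e below) =
    ev-mu (strip-⇓ e) (λ m m<n → proj₁ (below m m<n) , strip-⇓ (proj₂ (below m m<n)))
  strip-⇓ ev-orc         = ev-zer

  stripAll-⇓ : ∀ {O gs xs ys} → EvalAll ∅O gs xs ys → EvalAll O (stripAll gs) xs ys
  stripAll-⇓ ea-[]       = ea-[]
  stripAll-⇓ (ea-∷ e es) = ea-∷ (strip-⇓ e) (stripAll-⇓ es)

-- Functions computed by codes

-- Right-nested products rather than vectors: their η-law lets the function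
-- computed by a code be read off as an ordinary λ-term.
Env : ℕ → Set
Env zero    = ⊤
Env (suc n) = ℕ × Env n

args : ∀ n → Env n → List ℕ
args zero    _       = []
args (suc n) (x , v) = x ∷ args n v

look : ∀ {n} → Fin n → Env n → ℕ
look zero    v = proj₁ v
look (suc i) v = look i (proj₂ v)

nth-args : ∀ {n} (i : Fin n) v → nth (args n v) (toℕ i) ≡ just (look i v)
nth-args zero    v = refl
nth-args (suc i) v = nth-args i (proj₂ v)

-- The function is an index of the type, so assembling a code proves at the same time what it
-- computes. Only total functions are covered; unbounded search is handled by `search`.
record Comp (O : ℕ → Bool) (n : ℕ) (f : Env n → ℕ) : Set where
  constructor mkComp
  field
    code : Code
    run  : ∀ v → O ⊢ code [ args n v ]⇓ f v
open Comp

record Args (O : ℕ → Bool) (n k : ℕ) (F : Env n → Env k) : Set where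
  constructor mkArgs
  field
    codes  : List Code
    runAll : ∀ v → EvalAll O codes (args n v) (args k (F v))
open Args

lift : ∀ {O n f} → Comp ∅O n f → Comp O n f
lift c = mkComp (strip (code c)) (λ v → strip-⇓ (run c v))

natrec : ℕ → (ℕ → ℕ → ℕ) → ℕ → ℕ
natrec z s zero    = z
natrec z s (suc n) = s n (natrec z s n)

projections : ℕ → ℕ → List Code
projections d zero    = []
projections d (suc n) = proj d ∷ projections (suc d) n

skip : ∀ d {n} → Env (d + n) → Env n
skip zero    v = v
skip (suc d) v = skip d (proj₂ v)

nth-skip : ∀ d {n} (v : Env (d + n)) i y →
           nth (args n (skip d v)) i ≡ just y → nth (args (d + n) v) (d + i) ≡ just y
nth-skip zero    v i y eq = eq
nth-skip (suc d) v i y eq = nth-skip d (proj₂ v) i y eq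

sum< : ℕ → (ℕ → ℕ) → ℕ
sum< zero    f = 0
sum< (suc n) f = f n + sum< n f

module _ {O : ℕ → Bool} where

  ext : ∀ {n f g} → (∀ v → f v ≡ g v) → Comp O n f → Comp O n g
  ext eq c = mkComp (code c) (λ v → ⇓-resp-≡ (eq v) (run c v))

  infixr 5 _∷ᵃ_
  []ᵃ : ∀ {n} → Args O n 0 (λ _ → tt)
  []ᵃ = mkArgs [] (λ _ → ea-[])

  _∷ᵃ_ : ∀ {n k f F} → Comp O n f → Args O n k F → Args O n (suc k) (λ v → f v , F v)
  c ∷ᵃ as = mkArgs (code c ∷ codes as) (λ v → ea-∷ (run c v) (runAll as v))

  call : ∀ {n k g F} → Comp O k g → Args O n k F → Comp O n (λ v → g (F v))
  call c as = mkComp (comp (code c) (codes as)) (λ v → ev-comp (runAll as v) (run c _))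

  var : ∀ {n} (i : Fin n) → Comp O n (look i)
  var i = mkComp (proj (toℕ i)) (λ v → ev-proj (nth-args i v))

  projections-⇓ : ∀ {xs} d n (v : Env n) →
    (∀ i y → nth (args n v) i ≡ just y → nth xs (d + i) ≡ just y) →
    EvalAll O (projections d n) xs (args n v)
  projections-⇓ d zero    v h = ea-[]
  projections-⇓ {xs} d (suc n) (x , v) h =
    ea-∷ (ev-proj (subst (λ j → nth xs j ≡ just x) (+-identityʳ d) (h 0 x refl)))
         (projections-⇓ (suc d) n v
           (λ i y eq → subst (λ j → nth xs j ≡ just y) (+-suc d i) (h (suc i) y eq)))

  drop : ∀ d {n} → Args O (d + n) n (skip d)
  drop d {n} = mkArgs (projections d n) (λ v → projections-⇓ d n (skip d v) (nth-skip d v))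

  wk : ∀ {n f} → Comp O n f → Comp O (suc n) (λ v → f (proj₂ v))
  wk c = call c (drop 1)

  recᶜ : ∀ {n z s b} → Comp O n z → Comp O (2 + n) s → Comp O n b →
         Comp O n (λ v → natrec (z v) (λ i a → s (i , a , v)) (b v))
  recᶜ {n} {z} {s} {b} zc sc bc = call loop (bc ∷ᵃ drop 0)
    where
    steps : ∀ i v → O ⊢ prec (code zc) (code sc) [ i ∷ args n v ]⇓ natrec (z v) (λ j a → s (j , a , v)) i
    steps zero    v = ev-prec0 (run zc v)
    steps (suc i) v = ev-precS (steps i v) (run sc (i , _ , v))
    loop : Comp O (suc n) (λ w → natrec (z (proj₂ w)) (λ i a → s (i , a , proj₂ w)) (proj₁ w))
    loop = mkComp (prec (code zc) (code sc)) (λ w → steps (proj₁ w) (proj₂ w))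

  sucᶜ : ∀ {n f} → Comp O n f → Comp O n (λ v → suc (f v))
  sucᶜ c = mkComp (comp sucC (code c ∷ [])) (λ v → ev-comp (ea-∷ (run c v) ea-[]) ev-suc)

  const : ∀ {n} k → Comp O n (λ _ → k)
  const zero    = mkComp zer (λ _ → ev-zer)
  const (suc k) = sucᶜ (const k)

  infixl 6 _+ᶜ_ _∸ᶜ_
  infixl 7 _*ᶜ_
  infixr 8 2^ᶜ_

  _+ᶜ_ : ∀ {n f g} → Comp O n f → Comp O n g → Comp O n (λ v → f v + g v)
  _+ᶜ_ {f = f} {g} a b = ext (λ v → lemma (f v) (g v)) (recᶜ b (sucᶜ (var (suc zero))) a)
    where
    lemma : ∀ x y → natrec y (λ _ a → suc a) x ≡ x + y
    lemma zero    y = refl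
    lemma (suc x) y = cong suc (lemma x y)

  _*ᶜ_ : ∀ {n f g} → Comp O n f → Comp O n g → Comp O n (λ v → f v * g v)
  _*ᶜ_ {f = f} {g} a b = ext (λ v → lemma (f v) (g v)) (recᶜ (const 0) (wk (wk b) +ᶜ var (suc zero)) a)
    where
    lemma : ∀ x y → natrec 0 (λ _ a → y + a) x ≡ x * y
    lemma zero    y = refl
    lemma (suc x) y = cong (y +_) (lemma x y)

  predᶜ : ∀ {n f} → Comp O n f → Comp O n (λ v → pred (f v))
  predᶜ {f = f} a = ext (λ v → lemma (f v)) (recᶜ (const 0) (var zero) a)
    where
    lemma : ∀ x → natrec 0 (λ i _ → i) x ≡ pred x
    lemma zero    = refl
    lemma (suc x) = refl

  _∸ᶜ_ : ∀ {n f g} → Comp O n f → Comp O n g → Comp O n (λ v → f v ∸ g v)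
  _∸ᶜ_ {f = f} {g} a b = ext (λ v → lemma (f v) (g v)) (recᶜ a (predᶜ (var (suc zero))) b)
    where
    lemma : ∀ x y → natrec x (λ _ a → pred a) y ≡ x ∸ y
    lemma x zero    = refl
    lemma x (suc y) = trans (cong pred (lemma x y)) (pred[m∸n]≡m∸[1+n] x y)

  2^ᶜ_ : ∀ {n f} → Comp O n f → Comp O n (λ v → 2 ^ f v)
  2^ᶜ_ {f = f} a = ext (λ v → lemma (f v)) (recᶜ (const 1) (const 2 *ᶜ var (suc zero)) a)
    where
    lemma : ∀ x → natrec 1 (λ _ a → 2 * a) x ≡ 2 ^ x
    lemma zero    = refl
    lemma (suc x) = cong (2 *_) (lemma x)

  sumᶜ : ∀ {n b f} → Comp O n b → Comp O (suc n) f → Comp O n (λ v → sum< (b v) (λ i → f (i , v)))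
  sumᶜ {n} {b} {f} bc fc = ext (λ v → lemma v (b v))
    (recᶜ (const 0) (call fc (var zero ∷ᵃ drop 2) +ᶜ var (suc zero)) bc)
    where
    lemma : ∀ v x → natrec 0 (λ i a → f (i , v) + a) x ≡ sum< x (λ i → f (i , v))
    lemma v zero    = refl
    lemma v (suc x) = cong (f (x , v) +_) (lemma v x)

-- Finite sums

sum<-cong : ∀ n {f g} → (∀ i → i < n → f i ≡ g i) → sum< n f ≡ sum< n g
sum<-cong zero    eq = refl
sum<-cong (suc n) eq = cong₂ _+_ (eq n ≤-refl) (sum<-cong n (λ i i<n → eq i (m<n⇒m<1+n i<n)))

sum<-mono : ∀ n {f g} → (∀ i → i < n → f i ≤ g i) → sum< n f ≤ sum< n g
sum<-mono zero    le = z≤n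
sum<-mono (suc n) le = +-mono-≤ (le n ≤-refl) (sum<-mono n (λ i i<n → le i (m<n⇒m<1+n i<n)))

sum<-monoˡ : ∀ {m n} f → m ≤ n → sum< m f ≤ sum< n f
sum<-monoˡ {n = zero}  f z≤n = z≤n
sum<-monoˡ {m} {suc n} f m≤1+n with m≤n⇒m<n∨m≡n m≤1+n
... | inj₁ (s≤s m≤n) = ≤-trans (sum<-monoˡ f m≤n) (m≤n+m _ (f n))
... | inj₂ refl      = ≤-refl

sum<-zero : ∀ n {f} → (∀ i → i < n → f i ≡ 0) → sum< n f ≡ 0
sum<-zero zero    eq = refl
sum<-zero (suc n) eq = cong₂ _+_ (eq n ≤-refl) (sum<-zero n (λ i i<n → eq i (m<n⇒m<1+n i<n)))

term≤sum< : ∀ {i n} f → i < n → f i ≤ sum< n f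
term≤sum< {i} {n} f i<n = ≤-trans (m≤m+n (f i) _) (sum<-monoˡ {suc i} f i<n)

-- Pairing

data Parity : ℕ → Set where
  even : ∀ q → Parity (2 * q)
  odd  : ∀ q → Parity (suc (2 * q))

parityView : ∀ n → Parity n
parityView zero = even 0
parityView (suc n) with parityView n
... | even q = odd q
... | odd q  = subst Parity (cong suc (+-suc q (q + 0))) (even (suc q))

pair-zero : ∀ b → pair 0 b ≡ suc (2 * b)
pair-zero b = +-identityʳ _

pair-suc : ∀ a b → pair (suc a) b ≡ 2 * pair a b
pair-suc a b = *-assoc 2 (2 ^ a) (suc (2 * b))

pair-injective : ∀ a b c d → pair a b ≡ pair c d → a ≡ c × b ≡ d
pair-injective zero b zero d eq =
  refl , *-cancelˡ-≡ b d 2 (suc-injective (trans (sym (pair-zero b)) (trans eq (pair-zero d))))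
pair-injective zero b (suc c) d eq =
  ⊥-elim (even≢odd (pair c d) b (trans (sym (pair-suc c d)) (trans (sym eq) (pair-zero b))))
pair-injective (suc a) b zero d eq =
  ⊥-elim (even≢odd (pair a b) d (trans (sym (pair-suc a b)) (trans eq (pair-zero d))))
pair-injective (suc a) b (suc c) d eq
  with pair-injective a b c d (*-cancelˡ-≡ (pair a b) (pair c d) 2
         (trans (sym (pair-suc a b)) (trans eq (pair-suc c d))))
... | refl , refl = refl , refl

n<2^n : ∀ n → n < 2 ^ n
n<2^n zero    = s≤s z≤n
n<2^n (suc n) = ≤-trans (s≤s (n<2^n n))
  (≤-trans (+-monoˡ-≤ (2 ^ n) (≤-trans (s≤s z≤n) (n<2^n n))) (≤-reflexive (cong (2 ^ n +_) (sym (+-identityʳ _)))))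

0<2^n : ∀ n → 0 < 2 ^ n
0<2^n n = ≤-<-trans z≤n (n<2^n n)

pairˡ< : ∀ a b → a < pair a b
pairˡ< a b = <-≤-trans (n<2^n a) (m≤m*n (2 ^ a) (suc (2 * b)))

pairʳ< : ∀ a b → b < pair a b
pairʳ< a b = <-≤-trans (s≤s (m≤m+n b _)) (m≤n*m (suc (2 * b)) (2 ^ a) {{>-nonZero (0<2^n a)}})

opaque
  -- An opaque copy of `pair`, so that Gödel numbers stay symbolic and are not unfolded into powers
  -- of two.
  couple : ℕ → ℕ → ℕ
  couple = pair

  couple≡pair : ∀ a b → couple a b ≡ pair a b
  couple≡pair a b = refl

  couple-zero : ∀ b → suc (2 * b) ≡ couple 0 b
  couple-zero b = sym (pair-zero b)

  couple-suc : ∀ a b → 2 * couple a b ≡ couple (suc a) b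
  couple-suc a b = sym (pair-suc a b)

  couple-injective : ∀ a b c d → couple a b ≡ couple c d → a ≡ c × b ≡ d
  couple-injective = pair-injective

  coupleˡ< : ∀ a b → a < couple a b
  coupleˡ< = pairˡ<

  coupleʳ< : ∀ a b → b < couple a b
  coupleʳ< = pairʳ<

data Unpair : ℕ → Set where
  isZero : Unpair 0
  isCouple : ∀ a b → Unpair (couple a b)

-- A positive number is halved until it is odd; the number of halvings is the first component.
unpair : ∀ n → Unpair n
unpair = <-rec Unpair step
  where
  double : ∀ {q} → Unpair q → Unpair (2 * q)
  double isZero       = isZero
  double (isCouple a b) = subst Unpair (sym (couple-suc a b)) (isCouple (suc a) b)
  step : ∀ n → (∀ {m} → m < n → Unpair m) → Unpair n
  step n rec with parityView n
  ... | odd q        = subst Unpair (sym (couple-zero q)) (isCouple 0 q)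
  ... | even zero    = isZero
  ... | even (suc q) = double (rec (m<m+n (suc q) (s≤s z≤n)))

first second : ∀ {n} → Unpair n → ℕ
first isZero       = 0
first (isCouple a b) = a
second isZero       = 0
second (isCouple a b) = b

opaque
  π₁ π₂ : ℕ → ℕ
  π₁ n = first (unpair n)
  π₂ n = second (unpair n)

  π-couple : ∀ a b → π₁ (couple a b) ≡ a × π₂ (couple a b) ≡ b
  π-couple a b = lemma (unpair (couple a b)) refl
    where
    lemma : ∀ {n} (u : Unpair n) → n ≡ couple a b → first u ≡ a × second u ≡ b
    lemma isZero       eq = ⊥-elim (m<n⇒n≢0 (coupleˡ< a b) (sym eq))
    lemma (isCouple c d) eq = couple-injective c d a b eq

  π₁-couple : ∀ a b → π₁ (couple a b) ≡ a
  π₁-couple a b = proj₁ (π-couple a b)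

  π₂-couple : ∀ a b → π₂ (couple a b) ≡ b
  π₂-couple a b = proj₂ (π-couple a b)

  π₁≤ : ∀ n → π₁ n ≤ n
  π₁≤ n with unpair n
  ... | isZero     = z≤n
  ... | isCouple a b = <⇒≤ (coupleˡ< a b)

  π₁-0 : π₁ 0 ≡ 0
  π₁-0 = lemma (unpair 0) refl
    where
    lemma : ∀ {n} (u : Unpair n) → n ≡ 0 → first u ≡ 0
    lemma isZero       _  = refl
    lemma (isCouple a b) eq = ⊥-elim (m<n⇒n≢0 (coupleˡ< a b) eq)

  π₂-0 : π₂ 0 ≡ 0
  π₂-0 = lemma (unpair 0) refl
    where
    lemma : ∀ {n} (u : Unpair n) → n ≡ 0 → second u ≡ 0
    lemma isZero       _  = refl
    lemma (isCouple a b) eq = ⊥-elim (m<n⇒n≢0 (coupleˡ< a b) eq)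

  π₂≤ : ∀ n → π₂ n ≤ n
  π₂≤ n with unpair n
  ... | isZero     = z≤n
  ... | isCouple a b = <⇒≤ (coupleʳ< a b)

-- Coding of lists and tables

encodeList : List ℕ → ℕ
encodeList []       = 0
encodeList (x ∷ xs) = couple x (encodeList xs)

couple≢0 : ∀ a b → couple a b ≢ 0
couple≢0 a b eq = m<n⇒n≢0 (coupleˡ< a b) eq

encodeList-injective : ∀ xs ys → encodeList xs ≡ encodeList ys → xs ≡ ys
encodeList-injective []       []       eq = refl
encodeList-injective []       (y ∷ ys) eq = ⊥-elim (couple≢0 y (encodeList ys) (sym eq))
encodeList-injective (x ∷ xs) []       eq = ⊥-elim (couple≢0 x (encodeList xs) eq)
encodeList-injective (x ∷ xs) (y ∷ ys) eq with couple-injective x (encodeList xs) y (encodeList ys) eq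
... | refl , eq′ = cong (x ∷_) (encodeList-injective xs ys eq′)

-- Every number codes a list. Hence rules that mention arbitrary numbers as arguments still speak
-- about actual argument lists.
encodeList-surjective : ∀ n → ∃ λ xs → encodeList xs ≡ n
encodeList-surjective = <-rec _ step
  where
  step : ∀ n → (∀ {m} → m < n → ∃ λ xs → encodeList xs ≡ m) → ∃ λ xs → encodeList xs ≡ n
  step n rec with unpair n
  ... | isZero = [] , refl
  ... | isCouple a b with rec (coupleʳ< a b)
  ...   | xs , refl = a ∷ xs , refl

iterate : (ℕ → ℕ) → ℕ → ℕ → ℕ
iterate f x n = natrec x (λ _ a → f a) n

-- A coded list whose head is the value at the largest argument, so applications of `π₂` discard
-- values from the top.
table : ℕ → (ℕ → ℕ) → ℕ
table n f = natrec 0 (λ i t → couple (f i) t) n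

iterate-table : ∀ f n d → d ≤ n → iterate π₂ (table n f) d ≡ table (n ∸ d) f
iterate-table f n zero    _   = refl
iterate-table f n (suc d) d<n = trans (cong π₂ (iterate-table f n d (<⇒≤ d<n)))
  (trans (cong (λ k → π₂ (table k f)) (+-∸-assoc 1 d<n)) (π₂-couple (f (n ∸ suc d)) (table (n ∸ suc d) f)))

-- Properties of all sufficiently late stages

Eventually : (ℕ → Set) → Set
Eventually P = ∃ λ b → ∀ s → b ≤ s → P s

always : ∀ {P : ℕ → Set} → (∀ s → P s) → Eventually P
always p = 0 , λ s _ → p s

eventually-map : ∀ {P Q : ℕ → Set} → (∀ s → P s → Q s) → Eventually P → Eventually Q
eventually-map f (b , p) = b , λ s b≤s → f s (p s b≤s)

infixr 2 _⊗_
-- The maximum of two bounds serves both properties. Asking for all late stages rather than for one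
-- lets premises of different age be combined without showing that stages are monotone.
_⊗_ : ∀ {P Q : ℕ → Set} → Eventually P → Eventually Q → Eventually (λ s → P s × Q s)
(b , p) ⊗ (c , q) = b ⊔ c , λ s le → p s (m⊔n≤o⇒m≤o b c le) , q s (m⊔n≤o⇒n≤o b c le)

eventually-< : ∀ i → Eventually (λ s → i < s)
eventually-< i = suc i , λ s le → le

eventually-∃ : ∀ {P : ℕ → ℕ → Set} i → Eventually (λ s → P s i) →
               Eventually (λ s → ∃ λ j → j < s × P s j)
eventually-∃ i p = eventually-map (λ s q → i , q) (eventually-< i ⊗ p)

eventually-∀ : ∀ {P : ℕ → ℕ → Set} n → (∀ i → i < n → Eventually (λ s → P s i)) →
               Eventually (λ s → ∀ i → i < n → P s i)
eventually-∀ zero    p = always (λ s i ())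
eventually-∀ {P} (suc n) p = eventually-map split
  (p n ≤-refl ⊗ eventually-∀ n (λ i i<n → p i (m<n⇒m<1+n i<n)))
  where
  split : ∀ s → P s n × (∀ i → i < n → P s i) → ∀ i → i < suc n → P s i
  split s (q , r) i (s≤s i≤n) with m≤n⇒m<n∨m≡n i≤n
  ... | inj₁ i<n  = r i i<n
  ... | inj₂ refl = q

-- Gödel numbers of codes

mutual
  number : Code → ℕ
  number zer         = couple 0 0
  number sucC        = couple 1 0
  number (proj i)    = couple 2 i
  number (comp f gs) = couple 3 (couple (number f) (numbers gs))
  number (prec f g)  = couple 4 (couple (number f) (number g))
  number (mu f)      = couple 5 (number f)
  number orc         = couple 6 0

  numbers : List Code → ℕ
  numbers []       = 0
  numbers (c ∷ cs) = couple (number c) (numbers cs)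

mutual
  number≡encode : ∀ c → number c ≡ encode c
  number≡encode zer         = couple≡pair 0 0
  number≡encode sucC        = couple≡pair 1 0
  number≡encode (proj i)    = couple≡pair 2 i
  number≡encode (comp f gs) = trans (couple≡pair 3 _) (cong (pair 3)
    (trans (couple≡pair _ _) (cong₂ pair (number≡encode f) (numbers≡encodeL gs))))
  number≡encode (prec f g)  = trans (couple≡pair 4 _) (cong (pair 4)
    (trans (couple≡pair _ _) (cong₂ pair (number≡encode f) (number≡encode g))))
  number≡encode (mu f)      = trans (couple≡pair 5 _) (cong (λ c → pair 5 c) {number f} {encode f} (number≡encode f))
  number≡encode orc         = couple≡pair 6 0

  numbers≡encodeL : ∀ cs → numbers cs ≡ encodeL cs
  numbers≡encodeL []       = refl
  numbers≡encodeL (c ∷ cs) = trans (couple≡pair _ _) (cong₂ pair (number≡encode c) (numbers≡encodeL cs))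

tag payload : Code → ℕ
tag zer        = 0
tag sucC       = 1
tag (proj i)   = 2
tag (comp f gs) = 3
tag (prec f g) = 4
tag (mu f)     = 5
tag orc        = 6
payload zer        = 0
payload sucC       = 0
payload (proj i)   = i
payload (comp f gs) = couple (number f) (numbers gs)
payload (prec f g) = couple (number f) (number g)
payload (mu f)     = number f
payload orc        = 0

number≡ : ∀ c → number c ≡ couple (tag c) (payload c)
number≡ zer        = refl
number≡ sucC       = refl
number≡ (proj i)   = refl
number≡ (comp f gs) = refl
number≡ (prec f g) = refl
number≡ (mu f)     = refl
number≡ orc        = refl

mutual
  number-injective : ∀ c d → number c ≡ number d → c ≡ d
  number-injective c d eq with couple-injective (tag c) (payload c) (tag d) (payload d)
                                 (trans (sym (number≡ c)) (trans eq (number≡ d)))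
  ... | t , p = from-payload c d t p

  from-payload : ∀ c d → tag c ≡ tag d → payload c ≡ payload d → c ≡ d
  from-payload zer         zer           refl p = refl
  from-payload sucC        sucC          refl p = refl
  from-payload (proj i)    (proj j)      refl p = cong proj p
  from-payload (comp f gs) (comp f′ gs′) refl p
    with couple-injective (number f) (numbers gs) (number f′) (numbers gs′) p
  ... | q , r = cong₂ comp (number-injective f f′ q) (numbers-injective gs gs′ r)
  from-payload (prec f g)  (prec f′ g′)  refl p
    with couple-injective (number f) (number g) (number f′) (number g′) p
  ... | q , r = cong₂ prec (number-injective f f′ q) (number-injective g g′ r)
  from-payload (mu f)      (mu f′)       refl p = cong mu (number-injective f f′ p)
  from-payload orc         orc           refl p = refl

  numbers-injective : ∀ cs ds → numbers cs ≡ numbers ds → cs ≡ ds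
  numbers-injective []       []       eq = refl
  numbers-injective []       (d ∷ ds) eq = ⊥-elim (couple≢0 (number d) (numbers ds) (sym eq))
  numbers-injective (c ∷ cs) []       eq = ⊥-elim (couple≢0 (number c) (numbers cs) eq)
  numbers-injective (c ∷ cs) (d ∷ ds) eq
    with couple-injective (number c) (numbers cs) (number d) (numbers ds) eq
  ... | q , r = cong₂ _∷_ (number-injective c d q) (numbers-injective cs ds r)

-- Universal evaluation by finite stages

-- A fact is a kind together with three numbers.  Kinds 0 and 1 are the two
-- judgements of the big-step semantics, kind 2 is nth, kinds 3 and 4 say that a
-- number encodes a code, respectively a list of codes.
Facts : Set₁
Facts = ℕ → ℕ → ℕ → ℕ → Set

-- One disjunct per evaluation rule. Every quantifier is bounded, by the stage or by an argument,
-- which makes the rule decidable once the facts `Q` of the preceding stage are tabulated.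
EvalRule : ℕ → Facts → ℕ → ℕ → ℕ → Set
EvalRule s Q e xs y =
    (e ≡ couple 0 0 × y ≡ 0)
  ⊎ (e ≡ couple 1 0 × ∃ λ x → x < s × xs ≡ couple x 0 × y ≡ suc x)
  ⊎ (∃ λ i → i < s × e ≡ couple 2 i × Q 2 xs i y)
  ⊎ (∃ λ f → f < s × ∃ λ gs → gs < s × ∃ λ ys → ys < s ×
       e ≡ couple 3 (couple f gs) × Q 1 gs xs ys × Q 0 f ys y)
  ⊎ (∃ λ f → f < s × ∃ λ g → g < s × ∃ λ t → t < s ×
       -- The base case of a recursion never runs `g`, so it has to be required separately that `g`
       -- is the number of a code. Kinds 3 and 4 exist for this.
       e ≡ couple 4 (couple f g) × xs ≡ couple 0 t × Q 3 g 0 0 × Q 0 f t y)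
  ⊎ (∃ λ f → f < s × ∃ λ g → g < s × ∃ λ t → t < s × ∃ λ n → n < s × ∃ λ w → w < s ×
       e ≡ couple 4 (couple f g) × xs ≡ couple (suc n) t × Q 0 e (couple n t) w × Q 0 g (couple n (couple w t)) y)
  ⊎ (∃ λ f → f < s × e ≡ couple 5 f × Q 0 f (couple y xs) 0 ×
       (∀ m → m < y → ∃ λ k → k < s × Q 0 f (couple m xs) (suc k)))
  ⊎ (e ≡ couple 6 0 × ∃ λ x → x < s × xs ≡ couple x 0 × y ≡ 0)

EvalAllRule : ℕ → Facts → ℕ → ℕ → ℕ → Set
EvalAllRule s Q gs xs ys =
    (gs ≡ 0 × ys ≡ 0)
  ⊎ (∃ λ g → g < s × ∃ λ gs′ → gs′ < s × ∃ λ y → y < s × ∃ λ ys′ → ys′ < s ×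
       gs ≡ couple g gs′ × ys ≡ couple y ys′ × Q 0 g xs y × Q 1 gs′ xs ys′)

NthRule : ℕ → Facts → ℕ → ℕ → ℕ → Set
NthRule s Q xs i y =
    (∃ λ t → t < s × xs ≡ couple y t × i ≡ 0)
  ⊎ (∃ λ x → x < s × ∃ λ t → t < s × ∃ λ j → j < s × xs ≡ couple x t × i ≡ suc j × Q 2 t j y)

CodeRule : ℕ → Facts → ℕ → Set
CodeRule s Q n =
    n ≡ couple 0 0
  ⊎ n ≡ couple 1 0
  ⊎ (∃ λ i → i < s × n ≡ couple 2 i)
  ⊎ (∃ λ f → f < s × ∃ λ gs → gs < s × n ≡ couple 3 (couple f gs) × Q 3 f 0 0 × Q 4 gs 0 0)
  ⊎ (∃ λ f → f < s × ∃ λ g → g < s × n ≡ couple 4 (couple f g) × Q 3 f 0 0 × Q 3 g 0 0)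
  ⊎ (∃ λ f → f < s × n ≡ couple 5 f × Q 3 f 0 0)
  ⊎ n ≡ couple 6 0

CodesRule : ℕ → Facts → ℕ → Set
CodesRule s Q n =
  n ≡ 0 ⊎ (∃ λ c → c < s × ∃ λ cs → cs < s × n ≡ couple c cs × Q 3 c 0 0 × Q 4 cs 0 0)

Rule : ℕ → Facts → ℕ → ℕ → ℕ → ℕ → Set
Rule s Q k a b c =
    (k ≡ 0 × EvalRule s Q a b c)
  ⊎ (k ≡ 1 × EvalAllRule s Q a b c)
  ⊎ (k ≡ 2 × NthRule s Q a b c)
  ⊎ (k ≡ 3 × CodeRule s Q a)
  ⊎ (k ≡ 4 × CodesRule s Q a)

Meaning : Facts
Meaning 0 e xs y   = ∃ λ c → ∃ λ l → number c ≡ e × encodeList l ≡ xs × ∅O ⊢ c [ l ]⇓ y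
Meaning 1 gs xs ys = ∃ λ cs → ∃ λ l → ∃ λ r →
  numbers cs ≡ gs × encodeList l ≡ xs × encodeList r ≡ ys × EvalAll ∅O cs l r
Meaning 2 xs i y   = ∃ λ l → encodeList l ≡ xs × nth l i ≡ just y
Meaning 3 n _ _    = ∃ λ c → number c ≡ n
Meaning _ n _ _    = ∃ λ cs → numbers cs ≡ n

module RuleSound {s : ℕ} {Q : Facts} (h : ∀ k a b c → Q k a b c → Meaning k a b c) where

  evalRule-sound : ∀ {e xs y} → EvalRule s Q e xs y → Meaning 0 e xs y
  evalRule-sound {xs = xs} (inj₁ (refl , refl)) with encodeList-surjective xs
  ... | l , eq = zer , l , refl , eq , ev-zer
  evalRule-sound (inj₂ (inj₁ (refl , x , _ , refl , refl))) = sucC , x ∷ [] , refl , refl , ev-suc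
  evalRule-sound (inj₂ (inj₂ (inj₁ (i , _ , refl , q)))) with h _ _ _ _ q
  ... | l , eq , n = proj i , l , refl , eq , ev-proj n
  evalRule-sound (inj₂ (inj₂ (inj₂ (inj₁ (f , _ , gs , _ , ys , _ , refl , q , r)))))
    with h _ _ _ _ q | h _ _ _ _ r
  ... | cs , l , l′ , refl , eq , refl , as | c , l″ , refl , eq′ , ev
    with encodeList-injective l″ l′ eq′
  ... | refl = comp c cs , l , refl , eq , ev-comp as ev
  evalRule-sound (inj₂ (inj₂ (inj₂ (inj₂ (inj₁ (f , _ , g , _ , t , _ , refl , refl , q , r))))))
    with h _ _ _ _ q | h _ _ _ _ r
  ... | d , refl | c , l , refl , refl , ev = prec c d , 0 ∷ l , refl , refl , ev-prec0 ev
  evalRule-sound (inj₂ (inj₂ (inj₂ (inj₂ (inj₂ (inj₁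
      (f , _ , g , _ , t , _ , n , _ , w , _ , refl , refl , q , r)))))))
    with h _ _ _ _ q | h _ _ _ _ r
  ... | c , l , eqc , eql , ev | d , l′ , refl , eql′ , ev′
    with encodeList-surjective t
  ... | ts , refl with encodeList-injective l (n ∷ ts) eql | encodeList-injective l′ (n ∷ w ∷ ts) eql′
  ... | refl | refl = step c eqc ev
    where
    -- The premise about the shorter recursion only provides some code with this number; its tag
    -- shows that the code is a `prec`, with the expected components.
    step : ∀ c → number c ≡ couple 4 (couple f (number d)) → ∅O ⊢ c [ n ∷ ts ]⇓ w →
           Meaning 0 (couple 4 (couple f (number d))) (couple (suc n) (encodeList ts)) _
    step c eqc ev with couple-injective (tag c) (payload c) 4 (couple f (number d)) (trans (sym (number≡ c)) eqc)
    step (prec c₁ c₂) eqc ev | refl , p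
      with couple-injective (number c₁) (number c₂) f (number d) p
    ... | refl , eq with number-injective c₂ d eq
    ... | refl = prec c₁ c₂ , suc n ∷ ts , refl , refl , ev-precS ev ev′
  evalRule-sound {xs = xs} {y} (inj₂ (inj₂ (inj₂ (inj₂ (inj₂ (inj₂ (inj₁ (f , _ , refl , q , r))))))))
    with h _ _ _ _ q | encodeList-surjective xs
  ... | c , l , refl , eql , ev | ts , refl with encodeList-injective l (y ∷ ts) eql
  ... | refl = mu c , ts , refl , refl , ev-mu ev below
    where
    below : ∀ m → m < y → ∃ λ k → ∅O ⊢ c [ m ∷ ts ]⇓ suc k
    below m m<y with r m m<y
    ... | k , _ , q′ with h _ _ _ _ q′
    ... | d , l′ , eqd , eql′ , ev′ with number-injective d c eqd | encodeList-injective l′ (m ∷ ts) eql′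
    ... | refl | refl = k , ev′
  evalRule-sound (inj₂ (inj₂ (inj₂ (inj₂ (inj₂ (inj₂ (inj₂ (refl , x , _ , refl , refl)))))))) =
    orc , x ∷ [] , refl , refl , ev-orc

  evalAllRule-sound : ∀ {gs xs ys} → EvalAllRule s Q gs xs ys → Meaning 1 gs xs ys
  evalAllRule-sound {xs = xs} (inj₁ (refl , refl)) with encodeList-surjective xs
  ... | l , eq = [] , l , [] , refl , eq , refl , ea-[]
  evalAllRule-sound (inj₂ (g , _ , gs′ , _ , y , _ , ys′ , _ , refl , refl , q , r))
    with h _ _ _ _ q | h _ _ _ _ r
  ... | c , l , refl , eql , ev | cs , l′ , r′ , refl , refl , refl , evs
    with encodeList-injective l l′ eql
  ... | refl = c ∷ cs , l , y ∷ r′ , refl , refl , refl , ea-∷ ev evs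

  nthRule-sound : ∀ {xs i y} → NthRule s Q xs i y → Meaning 2 xs i y
  nthRule-sound {y = y} (inj₁ (t , _ , refl , refl)) with encodeList-surjective t
  ... | ts , refl = y ∷ ts , refl , refl
  nthRule-sound (inj₂ (x , _ , t , _ , j , _ , refl , refl , q)) with h _ _ _ _ q
  ... | l , refl , eq = x ∷ l , refl , eq

  codeRule-sound : ∀ {n} → CodeRule s Q n → Meaning 3 n 0 0
  codeRule-sound (inj₁ refl) = zer , refl
  codeRule-sound (inj₂ (inj₁ refl)) = sucC , refl
  codeRule-sound (inj₂ (inj₂ (inj₁ (i , _ , refl)))) = proj i , refl
  codeRule-sound (inj₂ (inj₂ (inj₂ (inj₁ (f , _ , gs , _ , refl , q , r)))))
    with h _ _ _ _ q | h _ _ _ _ r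
  ... | c , refl | cs , refl = comp c cs , refl
  codeRule-sound (inj₂ (inj₂ (inj₂ (inj₂ (inj₁ (f , _ , g , _ , refl , q , r))))))
    with h _ _ _ _ q | h _ _ _ _ r
  ... | c , refl | d , refl = prec c d , refl
  codeRule-sound (inj₂ (inj₂ (inj₂ (inj₂ (inj₂ (inj₁ (f , _ , refl , q))))))) with h _ _ _ _ q
  ... | c , refl = mu c , refl
  codeRule-sound (inj₂ (inj₂ (inj₂ (inj₂ (inj₂ (inj₂ refl)))))) = orc , refl

  codesRule-sound : ∀ {n} → CodesRule s Q n → Meaning 4 n 0 0
  codesRule-sound (inj₁ refl) = [] , refl
  codesRule-sound (inj₂ (c , _ , cs , _ , refl , q , r)) with h _ _ _ _ q | h _ _ _ _ r
  ... | d , refl | ds , refl = d ∷ ds , refl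

  rule-sound : ∀ {k a b c} → Rule s Q k a b c → Meaning k a b c
  rule-sound (inj₁ (refl , r))                      = evalRule-sound r
  rule-sound (inj₂ (inj₁ (refl , r)))               = evalAllRule-sound r
  rule-sound (inj₂ (inj₂ (inj₁ (refl , r))))        = nthRule-sound r
  rule-sound (inj₂ (inj₂ (inj₂ (inj₁ (refl , r))))) = codeRule-sound r
  rule-sound (inj₂ (inj₂ (inj₂ (inj₂ (refl , r))))) = codesRule-sound r

index : ℕ → ℕ → ℕ → ℕ → ℕ
index k a b c = couple k (couple a (couple b c))

-- Strings and their numbers

⌊2*n/2⌋≡n : ∀ n → ⌊ 2 * n /2⌋ ≡ n
⌊2*n/2⌋≡n n = trans (cong (λ k → ⌊ n + k /2⌋) (+-identityʳ n)) (sym (n≡⌊n+n/2⌋ n))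

⌊1+2*n/2⌋≡n : ∀ n → ⌊ suc (2 * n) /2⌋ ≡ n
⌊1+2*n/2⌋≡n zero = refl
⌊1+2*n/2⌋≡n (suc n) = trans (cong (λ k → ⌊ suc k /2⌋) (*-suc 2 n)) (cong suc (⌊1+2*n/2⌋≡n n))

odd?-2* : ∀ n → odd? (2 * n) ≡ false
odd?-2* zero    = refl
odd?-2* (suc n) = trans (cong odd? (*-suc 2 n)) (odd?-2* n)

odd?-1+2* : ∀ n → odd? (suc (2 * n)) ≡ true
odd?-1+2* zero    = refl
odd?-1+2* (suc n) = trans (cong (λ k → odd? (suc k)) (*-suc 2 n)) (odd?-1+2* n)

⌜decodeAux⌝ : ∀ f n → n ≤ f → ⌜ decodeAux f n ⌝ ≡ n
⌜decodeAux⌝ zero    zero    _ = refl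
⌜decodeAux⌝ (suc f) zero    _ = refl
⌜decodeAux⌝ (suc f) (suc m) (s≤s m≤f) with parityView m
... | even q rewrite odd?-2* q | ⌊2*n/2⌋≡n q =
  cong (λ k → suc (2 * k)) (⌜decodeAux⌝ f q (≤-trans (m≤m+n q _) m≤f))
... | odd q rewrite odd?-1+2* q | ⌊1+2*n/2⌋≡n q =
  cong (λ k → suc (suc (2 * k))) (⌜decodeAux⌝ f q (≤-trans (m≤m+n q _) (≤-trans (n≤1+n _) m≤f)))

⌜decode⌝ : ∀ n → ⌜ decode n ⌝ ≡ n
⌜decode⌝ n = ⌜decodeAux⌝ n n ≤-refl

⌜⌝-injective : ∀ s t → ⌜ s ⌝ ≡ ⌜ t ⌝ → s ≡ t
⌜⌝-injective []          []          eq = refl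
⌜⌝-injective []          (false ∷ t) ()
⌜⌝-injective []          (true ∷ t)  ()
⌜⌝-injective (false ∷ s) []          ()
⌜⌝-injective (true ∷ s)  []          ()
⌜⌝-injective (false ∷ s) (false ∷ t) eq =
  cong (false ∷_) (⌜⌝-injective s t (*-cancelˡ-≡ ⌜ s ⌝ ⌜ t ⌝ 2 (suc-injective eq)))
⌜⌝-injective (true ∷ s)  (true ∷ t)  eq =
  cong (true ∷_) (⌜⌝-injective s t (*-cancelˡ-≡ ⌜ s ⌝ ⌜ t ⌝ 2 (suc-injective (suc-injective eq))))
⌜⌝-injective (false ∷ s) (true ∷ t)  eq = ⊥-elim (even≢odd ⌜ s ⌝ ⌜ t ⌝ (suc-injective eq))
⌜⌝-injective (true ∷ s)  (false ∷ t) eq = ⊥-elim (even≢odd ⌜ t ⌝ ⌜ s ⌝ (sym (suc-injective eq)))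

decode-⌜⌝ : ∀ s → decode ⌜ s ⌝ ≡ s
decode-⌜⌝ s = ⌜⌝-injective _ s (⌜decode⌝ ⌜ s ⌝)

decode-odd : ∀ n → decode (suc (2 * n)) ≡ false ∷ decode n
decode-odd n = ⌜⌝-injective _ _ (trans (⌜decode⌝ _) (cong (λ k → suc (2 * k)) (sym (⌜decode⌝ n))))

decode-even : ∀ n → decode (suc (suc (2 * n))) ≡ true ∷ decode n
decode-even n = ⌜⌝-injective _ _ (trans (⌜decode⌝ _) (cong (λ k → suc (suc (2 * k))) (sym (⌜decode⌝ n))))

-- The strings of length l have the numbers from 2 ^ l - 1 to 2 ^ (l + 1) - 2. This is the lower
-- end, `<2^length` the upper one; together they characterise `len` arithmetically.
2^length≤ : ∀ s → 2 ^ length s ≤ suc ⌜ s ⌝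
2^length≤ []          = ≤-refl
2^length≤ (false ∷ s) = ≤-trans (*-monoʳ-≤ 2 (2^length≤ s)) (≤-reflexive (*-suc 2 ⌜ s ⌝))
2^length≤ (true ∷ s)  = ≤-trans (*-monoʳ-≤ 2 (2^length≤ s)) (≤-trans (≤-reflexive (*-suc 2 ⌜ s ⌝)) (n≤1+n _))

<2^length : ∀ s → suc ⌜ s ⌝ < 2 ^ suc (length s)
<2^length = lemma
  where
  doubled : ∀ n m → suc n < m → 4 + 2 * n ≤ 2 * m
  doubled n m 2+n≤m = ≤-trans
    (≤-reflexive (trans (cong (2 +_) (sym (*-suc 2 n))) (sym (*-suc 2 (suc n))))) (*-monoʳ-≤ 2 2+n≤m)
  lemma : ∀ s → suc ⌜ s ⌝ < 2 ^ suc (length s)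
  lemma []          = ≤-refl
  lemma (false ∷ s) = ≤-trans (n≤1+n _) (doubled ⌜ s ⌝ (2 ^ suc (length s)) (lemma s))
  lemma (true ∷ s)  = doubled ⌜ s ⌝ (2 ^ suc (length s)) (lemma s)

2^-cancel-≤ : ∀ {m n} → 2 ^ m ≤ 2 ^ n → m ≤ n
2^-cancel-≤ le = ≮⇒≥ (λ n<m → <⇒≱ (^-monoʳ-< 2 (s≤s (s≤s z≤n)) n<m) le)

2^-cancel-< : ∀ {m n} → 2 ^ m < 2 ^ n → m < n
2^-cancel-< lt = ≰⇒> (λ n≤m → <⇒≱ lt (^-monoʳ-≤ 2 n≤m))

len : ℕ → ℕ
len n = length (decode n)

2^len≤ : ∀ n → 2 ^ len n ≤ suc n
2^len≤ n = subst (λ k → 2 ^ len n ≤ suc k) (⌜decode⌝ n) (2^length≤ (decode n))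

<2^len : ∀ n → suc n < 2 ^ suc (len n)
<2^len n = subst (λ k → suc k < 2 ^ suc (len n)) (⌜decode⌝ n) (<2^length (decode n))

len-unique : ∀ n l → 2 ^ l ≤ suc n → suc n < 2 ^ suc l → len n ≡ l
len-unique n l lo hi = ≤-antisym
  (s≤s⁻¹ (2^-cancel-< (≤-<-trans (2^len≤ n) hi)))
  (s≤s⁻¹ (2^-cancel-< (≤-<-trans lo (<2^len n))))

len≤ : ∀ n → len n ≤ n
len≤ n = s≤s⁻¹ (<-≤-trans (n<2^n (len n)) (2^len≤ n))

len-mono : ∀ {m n} → m ≤ n → len m ≤ len n
len-mono {m} {n} m≤n = s≤s⁻¹ (2^-cancel-< (≤-<-trans (2^len≤ m) (≤-<-trans (s≤s m≤n) (<2^len n))))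

ones : ℕ → Str
ones zero    = []
ones (suc k) = true ∷ ones k

selfDelimited : ℕ → Str → Str
selfDelimited k w = ones k ++ false ∷ w

length-selfDelimited : ∀ k w → length (selfDelimited k w) ≡ suc (k + length w)
length-selfDelimited zero    w = refl
length-selfDelimited (suc k) w = cong suc (length-selfDelimited k w)

-- After adding 2, each leading 1 is a doubling, as 2 n + 4 = 2 (n + 2). The unary prefix becomes a
-- power of two, and a parser only has to unpair.
⌜selfDelimited⌝ : ∀ k w → 2 + ⌜ selfDelimited k w ⌝ ≡ couple k (suc ⌜ w ⌝)
⌜selfDelimited⌝ zero    w = trans (cong suc (sym (*-suc 2 ⌜ w ⌝))) (couple-zero (suc ⌜ w ⌝))
⌜selfDelimited⌝ (suc k) w = trans
  (trans (cong (2 +_) (sym (*-suc 2 ⌜ selfDelimited k w ⌝))) (sym (*-suc 2 (suc ⌜ selfDelimited k w ⌝))))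
  (trans (cong (2 *_) (⌜selfDelimited⌝ k w)) (couple-suc k (suc ⌜ w ⌝)))

-- Most significant digit first, unlike ⌜_⌝, so that the extensions of a string form an interval.
val : Str → ℕ
val []          = 0
val (false ∷ s) = val s
val (true ∷ s)  = 2 ^ length s + val s

val< : ∀ s → val s < 2 ^ length s
val< []          = s≤s z≤n
val< (false ∷ s) = <-≤-trans (val< s) (m≤m+n _ _)
val< (true ∷ s)  = ≤-trans (+-monoʳ-< (2 ^ length s) (val< s)) (≤-reflexive (cong (2 ^ length s +_) (sym (+-identityʳ _))))

val-++ : ∀ s t → val (s ++ t) ≡ val s * 2 ^ length t + val t
val-++ []          t = refl
val-++ (false ∷ s) t = val-++ s t
val-++ (true ∷ s)  t rewrite val-++ s t | length-++ s {t} | ^-distribˡ-+-* 2 (length s) (length t) =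
  lemma (2 ^ length s) (2 ^ length t) (val s) (val t)
  where
  lemma : ∀ a b x y → a * b + (x * b + y) ≡ (a + x) * b + y
  lemma = solve-∀

val-surjective : ∀ n q → q < 2 ^ n → ∃ λ w → length w ≡ n × val w ≡ q
val-surjective zero    zero    _         = [] , refl , refl
val-surjective zero    (suc q) (s≤s ())
val-surjective (suc n) q       q< with <-cmp q (2 ^ n)
... | tri< q<2^n _ _ with val-surjective n q q<2^n
...   | w , refl , eq = false ∷ w , refl , eq
val-surjective (suc n) q q< | tri≈ _ q≡ _ with val-surjective n 0 (0<2^n n)
...   | w , refl , eq = true ∷ w , refl , trans (cong (2 ^ length w +_) eq) (trans (+-identityʳ _) (sym q≡))
val-surjective (suc n) q q< | tri> _ _ 2^n<q with val-surjective n (q ∸ 2 ^ n)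
    (≤-trans (≤-reflexive (sym (+-∸-assoc 1 (<⇒≤ 2^n<q)))) (≤-trans (∸-monoˡ-≤ (2 ^ n) q<)
      (≤-reflexive (trans (m+n∸m≡n (2 ^ n) _) (+-identityʳ _)))))
...   | w , refl , eq = true ∷ w , refl , trans (cong (2 ^ length w +_) eq) (m+[n∸m]≡n (<⇒≤ 2^n<q))

-- More on finite sums, and the full binary tree

sum<-+ : ∀ n f g → sum< n (λ i → f i + g i) ≡ sum< n f + sum< n g
sum<-+ zero    f g = refl
sum<-+ (suc n) f g = trans (cong (f n + g n +_) (sum<-+ n f g)) (lemma (f n) (g n) (sum< n f) (sum< n g))
  where
  lemma : ∀ a b x y → a + b + (x + y) ≡ a + x + (b + y)
  lemma = solve-∀

sum<-* : ∀ n c f → sum< n (λ i → c * f i) ≡ c * sum< n f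
sum<-* zero    c f = sym (*-zeroʳ c)
sum<-* (suc n) c f = trans (cong (c * f n +_) (sum<-* n c f)) (sym (*-distribˡ-+ c (f n) (sum< n f)))

sum<-const : ∀ n c → sum< n (λ _ → c) ≡ n * c
sum<-const zero    c = refl
sum<-const (suc n) c = cong (c +_) (sum<-const n c)

sum<-swap : ∀ m n (f : ℕ → ℕ → ℕ) → sum< m (λ i → sum< n (f i)) ≡ sum< n (λ j → sum< m (λ i → f i j))
sum<-swap zero    n f = sym (sum<-zero n (λ _ _ → refl))
sum<-swap (suc m) n f = trans (cong (sum< n (f m) +_) (sum<-swap m n f)) (sym (sum<-+ n _ _))

-- Separates the root of a binary tree from its two subtrees: putting a bit in front takes the
-- string numbered i to the one numbered 2 i + 1 or 2 i + 2.
sum<-double : ∀ n f → sum< (suc (2 * n)) f ≡ f 0 + sum< n (λ i → f (suc (2 * i)) + f (suc (suc (2 * i))))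
sum<-double zero    f = refl
sum<-double (suc n) f = trans (cong (λ k → sum< (suc k) f) (*-suc 2 n))
  (trans (cong (λ x → f (suc (suc (2 * n))) + (f (suc (2 * n)) + x)) (sum<-double n f))
         (lemma (f (suc (2 * n))) (f (suc (suc (2 * n)))) (f 0) _))
  where
  lemma : ∀ a b x y → b + (a + (x + y)) ≡ x + (a + b + y)
  lemma = solve-∀

sum<-∣ : ∀ {d} n f → (∀ i → i < n → d ∣ f i) → d ∣ sum< n f
sum<-∣ {d} zero f h = d ∣0
sum<-∣ (suc n) f h = ∣m∣n⇒∣m+n (h n ≤-refl) (sum<-∣ n f (λ i i<n → h i (m<n⇒m<1+n i<n)))

-- 2 ^ (n + 1) - 1, the number of strings of length at most n.
fullTree : ℕ → ℕ
fullTree zero    = 1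
fullTree (suc n) = suc (2 * fullTree n)

n<fullTree : ∀ n → n < fullTree n
n<fullTree zero    = s≤s z≤n
n<fullTree (suc n) = s≤s (≤-trans (n<fullTree n) (m≤m+n _ _))

2^-split : ∀ {c l} → l ≤ c → 2 ^ c ≡ 2 ^ l * 2 ^ (c ∸ l)
2^-split {c} {l} l≤c = trans (cong (2 ^_) (sym (m+[n∸m]≡n l≤c))) (^-distribˡ-+-* 2 l (c ∸ l))

sum<-single : ∀ {n i} f → i < n → (∀ j → j < n → j ≢ i → f j ≡ 0) → sum< n f ≡ f i
sum<-single {suc n} {i} f i<1+n zeros with m≤n⇒m<n∨m≡n (s≤s⁻¹ i<1+n)
... | inj₁ i<n  = trans (cong (_+ sum< n f) (zeros n ≤-refl (λ n≡i → <⇒≢ i<n (sym n≡i))))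
                        (sum<-single f i<n (λ j j<n → zeros j (m<n⇒m<1+n j<n)))
... | inj₂ refl = trans (cong (f n +_) (sum<-zero n (λ j j<n → zeros j (m<n⇒m<1+n j<n) (<⇒≢ j<n)))) (+-identityʳ _)

selfDelimited-++ : ∀ k k′ w w′ σ → selfDelimited k w ++ σ ≡ selfDelimited k′ w′ → k ≡ k′ × w ++ σ ≡ w′
selfDelimited-++ zero    zero     w w′ σ refl = refl , refl
selfDelimited-++ zero    (suc k′) w w′ σ ()
selfDelimited-++ (suc k) zero     w w′ σ ()
selfDelimited-++ (suc k) (suc k′) w w′ σ eq with selfDelimited-++ k k′ w w′ σ (∷-injectiveʳ eq)
... | refl , eq′ = refl , eq′

-- The shape of `machine`: `q` searches for a parse, `g` extracts a string from it, and `f` is `U`.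
nested-intro : ∀ {O f g q xs x y z} → O ⊢ q [ xs ]⇓ x → O ⊢ g [ x ∷ [] ]⇓ y → O ⊢ f [ y ∷ [] ]⇓ z →
               O ⊢ comp f (comp g (q ∷ []) ∷ []) [ xs ]⇓ z
nested-intro q g f = ev-comp (ea-∷ (ev-comp (ea-∷ q ea-[]) g) ea-[]) f

nested-elim : ∀ {O f g q xs z} → O ⊢ comp f (comp g (q ∷ []) ∷ []) [ xs ]⇓ z → ∃ λ x → O ⊢ q [ xs ]⇓ x
nested-elim (ev-comp (ea-∷ (ev-comp (ea-∷ q ea-[]) _) ea-[]) _) = _ , q

-- Classical truth values and decidable predicates

module Classical (em : ExcludedMiddle 0ℓ) where

  by-cases : ∀ {ℓ} {C : Set ℓ} (P : Set) → (P → C) → (¬ P → C) → C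
  by-cases P f g with em {P}
  ... | yes p = f p
  ... | no ¬p = g ¬p

  opaque
    χ : Set → ℕ
    χ P = bit (does (em {P}))

    χ-yes : ∀ {P : Set} → P → χ P ≡ 1
    χ-yes {P} p with em {P}
    ... | yes _ = refl
    ... | no ¬p = ⊥-elim (¬p p)

    χ-no : ∀ {P : Set} → ¬ P → χ P ≡ 0
    χ-no {P} ¬p with em {P}
    ... | yes p = ⊥-elim (¬p p)
    ... | no _  = refl

  χ-unique : ∀ {P : Set} {x} → (P → x ≡ 1) → (¬ P → x ≡ 0) → x ≡ χ P
  χ-unique {P} one nil = by-cases P
    (λ p → trans (one p) (sym (χ-yes p))) (λ ¬p → trans (nil ¬p) (sym (χ-no ¬p)))

  χ-cong : ∀ {P Q : Set} → (P → Q) → (Q → P) → χ P ≡ χ Q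
  χ-cong to from = χ-unique (λ q → χ-yes (from q)) (λ ¬q → χ-no (λ p → ¬q (to p)))

  χ≡1⇒ : ∀ {P : Set} → χ P ≡ 1 → P
  χ≡1⇒ {P} eq = by-cases P (λ p → p) (λ ¬p → ⊥-elim (0≢1+n (trans (sym (χ-no ¬p)) eq)))

  χ≤1 : ∀ (P : Set) → χ P ≤ 1
  χ≤1 P = by-cases P (λ p → ≤-reflexive (χ-yes p)) (λ ¬p → ≤-trans (≤-reflexive (χ-no ¬p)) z≤n)

  opaque
    ¬¬-elim : ∀ {P : Set} → ¬ ¬ P → P
    ¬¬-elim {P} ¬¬p with em {P}
    ... | yes p = p
    ... | no ¬p = ⊥-elim (¬¬p ¬p)

  ¬∀⇒∃¬ : ∀ {A : Set} {P : A → Set} → ¬ (∀ x → P x) → ∃ λ x → ¬ P x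
  ¬∀⇒∃¬ ¬∀ = ¬¬-elim (λ ¬∃ → ¬∀ (λ x → ¬¬-elim (λ ¬p → ¬∃ (x , ¬p))))

  opaque
    least : ∀ {P : ℕ → Set} {n} → P n → ∃ λ i → P i × (∀ j → j < i → ¬ P j)
    least {P} {n} = <-rec (λ n → P n → ∃ λ i → P i × (∀ j → j < i → ¬ P j)) step n
      where
      step : ∀ n → (∀ {m} → m < n → P m → ∃ λ i → P i × (∀ j → j < i → ¬ P j)) →
             P n → ∃ λ i → P i × (∀ j → j < i → ¬ P j)
      step n rec p with em {∃ λ m → m < n × P m}
      ... | yes (m , m<n , q) = rec m<n q
      ... | no ¬∃             = n , p , λ j j<n q → ¬∃ (j , j<n , q)

  -- Excluded middle gives every predicate a characteristic function `χ`; decidability means that a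
  -- code computes it. Propositions can thus be handled classically while computability stays
  -- concrete.
  record CP (O : ℕ → Bool) (n : ℕ) (P : Env n → Set) : Set where
    constructor mkCP
    field
      indicator : Comp O n (λ v → χ (P v))
  open CP public

  liftᴾ : ∀ {O n P} → CP ∅O n P → CP O n P
  liftᴾ p = mkCP (lift (indicator p))

  module _ {O : ℕ → Bool} where

    iffᶜ : ∀ {n P Q} → (∀ v → P v → Q v) → (∀ v → Q v → P v) → CP O n P → CP O n Q
    iffᶜ to from p = mkCP (ext (λ v → χ-cong (to v) (from v)) (indicator p))

    callᴾ : ∀ {n k P F} → CP O k P → Args O n k F → CP O n (λ v → P (F v))
    callᴾ p as = mkCP (call (indicator p) as)

    infix  4 _≡ᶜ_ _≤ᶜ_ _<ᶜ_
    infixr 2 _×ᶜ_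
    infixr 1 _⊎ᶜ_

    _≤ᶜ_ : ∀ {n f g} → Comp O n f → Comp O n g → CP O n (λ v → f v ≤ g v)
    a ≤ᶜ b = mkCP (ext (λ v → χ-unique
      (λ le → cong (1 ∸_) (m≤n⇒m∸n≡0 le))
      (λ nle → m≤n⇒m∸n≡0 (m<n⇒0<n∸m (≰⇒> nle))))
      (const 1 ∸ᶜ (a ∸ᶜ b)))

    _<ᶜ_ : ∀ {n f g} → Comp O n f → Comp O n g → CP O n (λ v → f v < g v)
    a <ᶜ b = sucᶜ a ≤ᶜ b

    _×ᶜ_ : ∀ {n P Q} → CP O n P → CP O n Q → CP O n (λ v → P v × Q v)
    _×ᶜ_ {P = P} {Q} p q = mkCP (ext (λ v → χ-unique
      (λ pq → cong₂ _*_ (χ-yes (proj₁ pq)) (χ-yes (proj₂ pq)))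
      (λ ¬pq → lemma ¬pq))
      (indicator p *ᶜ indicator q))
      where
      lemma : ∀ {A B : Set} → ¬ (A × B) → χ A * χ B ≡ 0
      lemma {A} {B} ¬ab = by-cases A
        (λ a → trans (cong (χ A *_) (χ-no (λ b → ¬ab (a , b)))) (*-zeroʳ (χ A)))
        (λ ¬a → cong (_* χ B) (χ-no ¬a))

    ¬ᶜ : ∀ {n P} → CP O n P → CP O n (λ v → ¬ P v)
    ¬ᶜ p = mkCP (ext (λ v → χ-unique
      (λ ¬p → cong (1 ∸_) (χ-no ¬p))
      (λ ¬¬p → cong (1 ∸_) (χ-yes (¬¬-elim ¬¬p))))
      (const 1 ∸ᶜ indicator p))

    _⊎ᶜ_ : ∀ {n P Q} → CP O n P → CP O n Q → CP O n (λ v → P v ⊎ Q v)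
    p ⊎ᶜ q = iffᶜ
      (λ v ¬¬ → ¬¬-elim (λ ¬pq → ¬¬ ((λ x → ¬pq (inj₁ x)) , (λ y → ¬pq (inj₂ y)))))
      (λ v → [ (λ x n → proj₁ n x) , (λ y n → proj₂ n y) ]′)
      (¬ᶜ (¬ᶜ p ×ᶜ ¬ᶜ q))

    _≡ᶜ_ : ∀ {n f g} → Comp O n f → Comp O n g → CP O n (λ v → f v ≡ g v)
    a ≡ᶜ b = iffᶜ (λ v h → ≤-antisym (proj₁ h) (proj₂ h))
                  (λ v h → ≤-reflexive h , ≤-reflexive (sym h)) (a ≤ᶜ b ×ᶜ b ≤ᶜ a)

    ∃<ᶜ : ∀ {n b P} → Comp O n b → CP O (suc n) P → CP O n (λ v → ∃ λ i → i < b v × P (i , v))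
    ∃<ᶜ {n} {b} {P} bc p = mkCP (ext (λ v → χ-unique (some v) (none v))
        -- `1 ∸ (1 ∸ x)` is the sign of `x` and turns the number of witnesses into a truth value.
        (const 1 ∸ᶜ (const 1 ∸ᶜ sumᶜ bc (indicator p))))
      where
      some : ∀ v → (∃ λ i → i < b v × P (i , v)) → 1 ∸ (1 ∸ sum< (b v) (λ i → χ (P (i , v)))) ≡ 1
      some v (i , i<b , q) = cong (1 ∸_) (m≤n⇒m∸n≡0
        (≤-trans (≤-reflexive (sym (χ-yes q))) (term≤sum< (λ j → χ (P (j , v))) i<b)))
      none : ∀ v → ¬ (∃ λ i → i < b v × P (i , v)) → 1 ∸ (1 ∸ sum< (b v) (λ i → χ (P (i , v)))) ≡ 0
      none v ¬∃ = cong (λ x → 1 ∸ (1 ∸ x))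
        (sum<-zero (b v) (λ i i<b → χ-no (λ q → ¬∃ (i , i<b , q))))

    ∀<ᶜ : ∀ {n b P} → Comp O n b → CP O (suc n) P → CP O n (λ v → ∀ i → i < b v → P (i , v))
    ∀<ᶜ bc p = iffᶜ
      (λ v ¬∃ i i<b → ¬¬-elim (λ ¬q → ¬∃ (i , i<b , ¬q)))
      (λ v h ex → proj₂ (proj₂ ex) (h (proj₁ ex) (proj₁ (proj₂ ex))))
      (¬ᶜ (∃<ᶜ bc (¬ᶜ p)))

    -- In the sum of `y` times the indicator of `f v ≡ y` only the term `f v` survives. A computably
    -- bounded function with a decidable graph therefore needs no program of its own.
    graphᶜ : ∀ {n b} f → Comp O n b → (∀ v → f v ≤ b v) →
             CP O (suc n) (λ w → f (proj₂ w) ≡ proj₁ w) → Comp O n f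
    graphᶜ {n} {b} f bc f≤b p =
      ext (λ v → only (suc (b v)) (s≤s (f≤b v))) (sumᶜ (sucᶜ bc) (var zero *ᶜ indicator p))
      where
      only : ∀ {x} k → x < k → sum< k (λ y → y * χ (x ≡ y)) ≡ x
      only {x} (suc k) x<1+k with m≤n⇒m<n∨m≡n x<1+k
      ... | inj₂ refl = trans (cong₂ _+_ (trans (cong (x *_) (χ-yes refl)) (*-identityʳ x))
              (sum<-zero x (λ i i<x → trans (cong (i *_) (χ-no (λ eq → <⇒≢ i<x (sym eq)))) (*-zeroʳ i))))
              (+-identityʳ x)
      ... | inj₁ (s≤s x<k) = trans (cong (λ z → z + sum< k (λ y → y * χ (x ≡ y)))
              (trans (cong (k *_) (χ-no (λ eq → <⇒≢ x<k eq))) (*-zeroʳ k))) (only k x<k)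

    search : ∀ {n P} → CP O (suc n) P → Code
    search p = mu (code (const 1 ∸ᶜ indicator p))

    search-finds : ∀ {n P} (p : CP O (suc n) P) v {i} → P (i , v) → (∀ j → j < i → ¬ P (j , v)) →
                   O ⊢ search p [ args n v ]⇓ i
    search-finds {n} {P} p v {i} q below = ev-mu
      (⇓-resp-≡ (cong (1 ∸_) (χ-yes q)) (run miss (i , v)))
      (λ j j<i → 0 , ⇓-resp-≡ (cong (1 ∸_) (χ-no (below j j<i))) (run miss (j , v)))
      where miss = const 1 ∸ᶜ indicator p

    search-sound : ∀ {n P} (p : CP O (suc n) P) v {i} → O ⊢ search p [ args n v ]⇓ i → P (i , v)
    search-sound {n} {P} p v {i} (ev-mu e _) = hit (⇓-deterministic e (run (const 1 ∸ᶜ indicator p) (i , v)))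
      where
      hit : 0 ≡ 1 ∸ χ (P (i , v)) → P (i , v)
      hit eq = by-cases (P (i , v)) (λ q → q) (λ ¬q → ⊥-elim (0≢1+n (trans eq (cong (1 ∸_) (χ-no ¬q)))))

  coupleᶜ : ∀ {O n f g} → Comp O n f → Comp O n g → Comp O n (λ v → couple (f v) (g v))
  coupleᶜ {f = f} {g} a b = ext (λ v → sym (couple≡pair (f v) (g v))) (2^ᶜ a *ᶜ sucᶜ (const 2 *ᶜ b))

  π₁ᶜ : ∀ {O n f} → Comp O n f → Comp O n (λ v → π₁ (f v))
  π₁ᶜ {f = f} a = call fstᶜ (a ∷ᵃ []ᵃ)
    where
    graph : ∀ n x → ((∃ λ b → b < n × n ≡ couple x b) ⊎ (n ≡ 0 × x ≡ 0)) → π₁ n ≡ x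
    graph n x (inj₁ (b , _ , refl)) = π₁-couple x b
    graph n x (inj₂ (refl , refl)) = π₁-0
    graph′ : ∀ n x → π₁ n ≡ x → ((∃ λ b → b < n × n ≡ couple x b) ⊎ (n ≡ 0 × x ≡ 0))
    graph′ n x eq with unpair n
    graph′ n x refl | isZero     = inj₂ (refl , π₁-0)
    graph′ n x refl | isCouple a b = inj₁ (b , coupleʳ< a b , cong (λ c → couple c b) (sym (π₁-couple a b)))
    fstᶜ : ∀ {O} → Comp O 1 (λ w → π₁ (proj₁ w))
    fstᶜ = graphᶜ _ (var zero) (λ w → π₁≤ (proj₁ w)) (iffᶜ
      (λ w → graph (proj₁ (proj₂ w)) (proj₁ w)) (λ w → graph′ (proj₁ (proj₂ w)) (proj₁ w))
      (∃<ᶜ (var (suc zero)) (var (suc (suc zero)) ≡ᶜ coupleᶜ (var (suc zero)) (var zero))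
       ⊎ᶜ (var (suc zero) ≡ᶜ const 0 ×ᶜ var zero ≡ᶜ const 0)))

  π₂ᶜ : ∀ {O n f} → Comp O n f → Comp O n (λ v → π₂ (f v))
  π₂ᶜ {f = f} a = call sndᶜ (a ∷ᵃ []ᵃ)
    where
    graph : ∀ n x → ((∃ λ b → b < n × n ≡ couple b x) ⊎ (n ≡ 0 × x ≡ 0)) → π₂ n ≡ x
    graph n x (inj₁ (b , _ , refl)) = π₂-couple b x
    graph n x (inj₂ (refl , refl)) = π₂-0
    graph′ : ∀ n x → π₂ n ≡ x → ((∃ λ b → b < n × n ≡ couple b x) ⊎ (n ≡ 0 × x ≡ 0))
    graph′ n x eq with unpair n
    graph′ n x refl | isZero     = inj₂ (refl , π₂-0)
    graph′ n x refl | isCouple a b = inj₁ (a , coupleˡ< a b , cong (couple a) (sym (π₂-couple a b)))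
    sndᶜ : ∀ {O} → Comp O 1 (λ w → π₂ (proj₁ w))
    sndᶜ = graphᶜ _ (var zero) (λ w → π₂≤ (proj₁ w)) (iffᶜ
      (λ w → graph (proj₁ (proj₂ w)) (proj₁ w)) (λ w → graph′ (proj₁ (proj₂ w)) (proj₁ w))
      (∃<ᶜ (var (suc zero)) (var (suc (suc zero)) ≡ᶜ coupleᶜ (var zero) (var (suc zero)))
       ⊎ᶜ (var (suc zero) ≡ᶜ const 0 ×ᶜ var zero ≡ᶜ const 0)))

  -- Tables, iteration and course-of-values recursion

  opaque
    -- The position is counted from the end because tables begin with their last value. Outside the
    -- range the answer is 0, so a single number stands for a total function.
    entry : ℕ → ℕ → ℕ → ℕ
    entry t n y = χ (y < n) * π₁ (iterate π₂ t (n ∸ suc y))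

    entryᶜ : ∀ {O n t k y} → Comp O n t → Comp O n k → Comp O n y →
             Comp O n (λ v → entry (t v) (k v) (y v))
    entryᶜ t k y = indicator (y <ᶜ k) *ᶜ π₁ᶜ (recᶜ t (π₂ᶜ (var (suc zero))) (k ∸ᶜ sucᶜ y))

    entry-outside : ∀ t {n y} → ¬ (y < n) → entry t n y ≡ 0
    entry-outside t ¬y<n = cong (_* _) (χ-no ¬y<n)

    entry-table : ∀ f {n y} → y < n → entry (table n f) n y ≡ f y
    entry-table f {n} {y} y<n = trans (cong (_* _) (χ-yes y<n)) (trans (+-identityʳ _)
      (trans (cong π₁ (iterate-table f n (n ∸ suc y) (m∸n≤m n (suc y))))
        (trans (cong (λ k → π₁ (table k f)) (m∸[m∸n]≡n y<n)) (π₁-couple (f y) (table y f)))))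

  -- Stage `s` lives on the arguments below `s`. Each step recomputes the whole table and adds one
  -- argument, so every argument is reached although a stage is always one number.
  module Iteration {n : ℕ} (G : Env n → ℕ → (ℕ → ℕ) → ℕ → ℕ) where

    opaque
      tables : Env n → ℕ → ℕ
      tables v = natrec 0 (λ s t → table (suc s) (G v s (entry t s)))

      stage : Env n → ℕ → ℕ → ℕ
      stage v s y = entry (tables v s) s y

      stage-suc : ∀ v {s y} → y < suc s → stage v (suc s) y ≡ G v s (stage v s) y
      stage-suc v {s} y< = entry-table (G v s (stage v s)) y<

      stage-outside : ∀ v {s y} → ¬ (y < s) → stage v s y ≡ 0
      stage-outside v {s} ¬y< = entry-outside (tables v s) ¬y<

      stageᶜ : ∀ {O} → Comp O (3 + n) (λ { (y , t , s , v) → G v s (entry t s) y }) →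
               Comp O (2 + n) (λ { (y , s , v) → stage v s y })
      stageᶜ {O} g = entryᶜ (call tablesᶜ (drop 1)) (var (suc zero)) (var zero)
        where
        tablesᶜ : Comp O (1 + n) (λ { (s , v) → tables v s })
        tablesᶜ = recᶜ (const 0) tableᶜ (var zero)
          where
          tableᶜ : Comp O (2 + (1 + n)) (λ { (s , t , _ , v) → table (suc s) (G v s (entry t s)) })
          tableᶜ = recᶜ (const 0)
            (coupleᶜ (call g (var zero ∷ᵃ var (suc (suc (suc zero))) ∷ᵃ var (suc (suc zero)) ∷ᵃ drop 5))
                   (var (suc zero)))
            (sucᶜ (var zero))

  module CourseOfValues {n : ℕ} (G : Env n → ℕ → (ℕ → ℕ) → ℕ) where

    private
      -- Keeps the old values and adds the one at `x`; under iteration, stage `x` becomes the record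
      -- of all values below `x`.
      extend : Env n → ℕ → (ℕ → ℕ) → ℕ → ℕ
      extend v x h y = χ (y ≡ x) * G v x h + χ (y < x) * h y

    open Iteration extend public

    opaque
      value : Env n → ℕ → ℕ
      value v x = G v x (stage v x)

      value≡ : ∀ v x → value v x ≡ G v x (stage v x)
      value≡ v x = refl

      stage≡value : ∀ v {x y} → y < x → stage v x y ≡ value v y
      stage≡value v {suc x} {y} y<1+x with m≤n⇒m<n∨m≡n (s≤s⁻¹ y<1+x)
      ... | inj₁ y<x = trans (stage-suc v y<1+x)
            (trans (cong₂ _+_ (cong (_* G v x (stage v x)) (χ-no (<⇒≢ y<x)))
                              (trans (cong (_* stage v x y) (χ-yes y<x)) (+-identityʳ _)))
                   (stage≡value v y<x))
      ... | inj₂ refl = trans (stage-suc v y<1+x)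
            (trans (cong₂ _+_ (trans (cong (_* G v x (stage v x)) (χ-yes {x ≡ x} refl)) (+-identityʳ _))
                              (cong (_* stage v x x) (χ-no (<-irrefl refl))))
                   (+-identityʳ _))

      valueᶜ : ∀ {O} → Comp O (2 + n) (λ { (t , x , v) → G v x (entry t x) }) →
               Comp O (1 + n) (λ { (x , v) → value v x })
      valueᶜ {O} g = ext (λ { (x , v) → stage≡value v ≤-refl }) (call (stageᶜ extendᶜ) (var zero ∷ᵃ sucᶜ (var zero) ∷ᵃ drop 1))
        where
        extendᶜ : Comp O (3 + n) (λ { (y , t , x , v) → extend v x (entry t x) y })
        extendᶜ = indicator (var zero ≡ᶜ var (suc (suc zero))) *ᶜ call g (drop 1)
               +ᶜ indicator (var zero <ᶜ var (suc (suc zero)))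
                  *ᶜ entryᶜ (var (suc zero)) (var (suc (suc zero))) (var zero)

  -- Facts derivable by a stage: soundness and completeness

  private
    holds : (ℕ → ℕ) → Facts
    holds h k a b c = h (index k a b c) ≡ 1

    derivable : Env 0 → ℕ → (ℕ → ℕ) → ℕ → ℕ
    derivable _ s h z = χ (Rule s (holds h) (π₁ z) (π₁ (π₂ z)) (π₁ (π₂ (π₂ z))) (π₂ (π₂ (π₂ z))))

    module It = Iteration derivable

  Fact : ℕ → Facts
  Fact s = holds (It.stage tt s)

  private
    unindex : ∀ {ℓ} {A : Set ℓ} (F : ℕ → ℕ → ℕ → ℕ → A) k a b c → let z = index k a b c in
              F (π₁ z) (π₁ (π₂ z)) (π₁ (π₂ (π₂ z))) (π₂ (π₂ (π₂ z))) ≡ F k a b c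
    unindex F k a b c
      rewrite π₁-couple k (couple a (couple b c)) | π₂-couple k (couple a (couple b c))
            | π₁-couple a (couple b c) | π₂-couple a (couple b c) | π₁-couple b c | π₂-couple b c = refl

  fact-intro : ∀ {s k a b c} → index k a b c < suc s → Rule s (Fact s) k a b c → Fact (suc s) k a b c
  fact-intro {s} {k} {a} {b} {c} z< r = trans (It.stage-suc tt z<)
    (χ-yes (subst (λ A → A) (sym (unindex (Rule s (Fact s)) k a b c)) r))

  fact-elim : ∀ {s k a b c} → Fact (suc s) k a b c → Rule s (Fact s) k a b c
  fact-elim {s} {k} {a} {b} {c} q = by-cases (index k a b c < suc s)
    (λ z< → subst (λ A → A) (unindex (Rule s (Fact s)) k a b c)
              (χ≡1⇒ (trans (sym (It.stage-suc tt z<)) q)))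
    (λ z≮ → ⊥-elim (0≢1+n (trans (sym (It.stage-outside tt z≮)) q)))

  fact-sound : ∀ s k a b c → Fact s k a b c → Meaning k a b c
  fact-sound zero    k a b c q = ⊥-elim (0≢1+n (trans (sym (It.stage-outside tt (λ ()))) q))
  fact-sound (suc s) k a b c q = RuleSound.rule-sound (fact-sound s) (fact-elim q)

  -- A table has room only for arguments below its stage, so the stage must also outgrow the index
  -- of the fact.
  eventually-fact : ∀ {k a b c} → Eventually (λ s → Rule s (Fact s) k a b c) → Eventually (λ s → Fact s k a b c)
  eventually-fact {k} {a} {b} {c} r with r ⊗ eventually-< (index k a b c)
  ... | B , p = suc B , λ { (suc s) (s≤s B≤s) → fact-intro (m<n⇒m<1+n (proj₂ (p s B≤s))) (proj₁ (p s B≤s)) }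

  private
    Ev : ℕ → ℕ → ℕ → ℕ → Set
    Ev k a b c = Eventually (λ s → Fact s k a b c)

    trivial : ∀ {A : Set} {x : A} → Eventually (λ _ → x ≡ x)
    trivial = always (λ _ → refl)

  mutual
    code-complete : ∀ c → Ev 3 (number c) 0 0
    code-complete c = eventually-fact (eventually-map (λ s r → inj₂ (inj₂ (inj₂ (inj₁ (refl , r))))) (codeRule-complete c))

    codeRule-complete : ∀ c → Eventually (λ s → CodeRule s (Fact s) (number c))
    codeRule-complete zer  = always (λ s → inj₁ refl)
    codeRule-complete sucC = always (λ s → inj₂ (inj₁ refl))
    codeRule-complete (proj i) = eventually-map (λ s r → inj₂ (inj₂ (inj₁ r))) (eventually-∃ i trivial)
    codeRule-complete (comp f gs) = eventually-map (λ s r → inj₂ (inj₂ (inj₂ (inj₁ r))))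
      (eventually-∃ (number f) (eventually-∃ (numbers gs) (trivial ⊗ code-complete f ⊗ codes-complete gs)))
    codeRule-complete (prec f g) = eventually-map (λ s r → inj₂ (inj₂ (inj₂ (inj₂ (inj₁ r)))))
      (eventually-∃ (number f) (eventually-∃ (number g) (trivial ⊗ code-complete f ⊗ code-complete g)))
    codeRule-complete (mu f) = eventually-map (λ s r → inj₂ (inj₂ (inj₂ (inj₂ (inj₂ (inj₁ r))))))
      (eventually-∃ (number f) (trivial ⊗ code-complete f))
    codeRule-complete orc = always (λ s → inj₂ (inj₂ (inj₂ (inj₂ (inj₂ (inj₂ refl))))))

    codes-complete : ∀ cs → Ev 4 (numbers cs) 0 0
    codes-complete cs = eventually-fact (eventually-map (λ s r → inj₂ (inj₂ (inj₂ (inj₂ (refl , r))))) (codesRule-complete cs))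

    codesRule-complete : ∀ cs → Eventually (λ s → CodesRule s (Fact s) (numbers cs))
    codesRule-complete []       = always (λ s → inj₁ refl)
    codesRule-complete (c ∷ cs) = eventually-map (λ s r → inj₂ r)
      (eventually-∃ (number c) (eventually-∃ (numbers cs) (trivial ⊗ code-complete c ⊗ codes-complete cs)))

  nth-complete : ∀ xs i y → nth xs i ≡ just y → Ev 2 (encodeList xs) i y
  nth-complete (x ∷ xs) zero    .x refl = eventually-fact (eventually-map (λ s r → inj₂ (inj₂ (inj₁ (refl , inj₁ r))))
    (eventually-∃ (encodeList xs) (trivial ⊗ trivial)))
  nth-complete (x ∷ xs) (suc i) y  p = eventually-fact (eventually-map (λ s r → inj₂ (inj₂ (inj₁ (refl , inj₂ r))))
    (eventually-∃ x (eventually-∃ (encodeList xs) (eventually-∃ i (trivial ⊗ trivial ⊗ nth-complete xs i y p)))))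

  mutual
    eval-complete : ∀ {c xs y} → ∅O ⊢ c [ xs ]⇓ y → Ev 0 (number c) (encodeList xs) y
    eval-complete ev = eventually-fact (eventually-map (λ s r → inj₁ (refl , r)) (evalRule-complete ev))

    evalRule-complete : ∀ {c xs y} → ∅O ⊢ c [ xs ]⇓ y →
                        Eventually (λ s → EvalRule s (Fact s) (number c) (encodeList xs) y)
    evalRule-complete ev-zer = always (λ s → inj₁ (refl , refl))
    evalRule-complete (ev-suc {x}) = eventually-map (λ s r → inj₂ (inj₁ (refl , r))) (eventually-∃ x (trivial ⊗ trivial))
    evalRule-complete (ev-proj {i} {xs} {y} p) = eventually-map (λ s r → inj₂ (inj₂ (inj₁ r)))
      (eventually-∃ i (trivial ⊗ nth-complete xs i y p))
    evalRule-complete (ev-comp {f} {gs} {xs} {ys} as ev) = eventually-map (λ s r → inj₂ (inj₂ (inj₂ (inj₁ r))))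
      (eventually-∃ (number f) (eventually-∃ (numbers gs) (eventually-∃ (encodeList ys)
        (trivial ⊗ evalAll-complete as ⊗ eval-complete ev))))
    evalRule-complete (ev-prec0 {f} {g} {xs} ev) = eventually-map (λ s r → inj₂ (inj₂ (inj₂ (inj₂ (inj₁ r)))))
      (eventually-∃ (number f) (eventually-∃ (number g) (eventually-∃ (encodeList xs)
        (trivial ⊗ trivial ⊗ code-complete g ⊗ eval-complete ev))))
    evalRule-complete (ev-precS {f} {g} {n} {xs} {y} ev ev′) = eventually-map (λ s r → inj₂ (inj₂ (inj₂ (inj₂ (inj₂ (inj₁ r))))))
      (eventually-∃ (number f) (eventually-∃ (number g) (eventually-∃ (encodeList xs)
        (eventually-∃ n (eventually-∃ y (trivial ⊗ trivial ⊗ eval-complete ev ⊗ eval-complete ev′))))))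
    evalRule-complete (ev-mu {f} {xs} {n} ev below) = eventually-map (λ s r → inj₂ (inj₂ (inj₂ (inj₂ (inj₂ (inj₂ (inj₁ r)))))))
      (eventually-∃ (number f) (trivial ⊗ eval-complete ev ⊗
        eventually-∀ n (λ m m<n → eventually-∃ (proj₁ (below m m<n)) (eval-complete (proj₂ (below m m<n))))))
    evalRule-complete (ev-orc {x}) = eventually-map (λ s r → inj₂ (inj₂ (inj₂ (inj₂ (inj₂ (inj₂ (inj₂ (refl , r))))))))
      (eventually-∃ x (trivial ⊗ trivial))

    evalAll-complete : ∀ {gs xs ys} → EvalAll ∅O gs xs ys → Ev 1 (numbers gs) (encodeList xs) (encodeList ys)
    evalAll-complete as = eventually-fact (eventually-map (λ s r → inj₂ (inj₁ (refl , r))) (evalAllRule-complete as))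

    evalAllRule-complete : ∀ {gs xs ys} → EvalAll ∅O gs xs ys →
      Eventually (λ s → EvalAllRule s (Fact s) (numbers gs) (encodeList xs) (encodeList ys))
    evalAllRule-complete ea-[] = always (λ s → inj₁ (refl , refl))
    evalAllRule-complete (ea-∷ {g} {gs} {xs} {y} {ys} ev as) = eventually-map (λ s r → inj₂ r)
      (eventually-∃ (number g) (eventually-∃ (numbers gs) (eventually-∃ y (eventually-∃ (encodeList ys)
        (trivial ⊗ trivial ⊗ eval-complete ev ⊗ evalAll-complete as)))))

  -- Decidability of the stages

  module _ {O : ℕ → Bool} where

    private
      rule : Env 6 → Set
      rule (k , a , b , c , t , s , _) = Rule s (holds (entry t s)) k a b c

      fact : ∀ {n k a b c t s} → Comp O n k → Comp O n a → Comp O n b → Comp O n c → Comp O n t → Comp O n s →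
             CP O n (λ w → holds (entry (t w) (s w)) (k w) (a w) (b w) (c w))
      fact k a b c t s = entryᶜ t s (coupleᶜ k (coupleᶜ a (coupleᶜ b c))) ≡ᶜ const 1

      -- The preceding stage arrives as a table `t` of length `s`, the form in which `Iteration`
      -- passes it on. Indices are de Bruijn: each bounded quantifier puts its variable in front, so
      -- `s` is `# 4` outside and moves up by one under every binder.
      evalRuleᶜ : CP O 5 (λ { (e , xs , y , t , s , _) → EvalRule s (holds (entry t s)) e xs y })
      evalRuleᶜ =
          (e ≡ᶜ coupleᶜ (const 0) (const 0) ×ᶜ y ≡ᶜ const 0)
        ⊎ᶜ (e ≡ᶜ coupleᶜ (const 1) (const 0) ×ᶜ ∃<ᶜ s (wk xs ≡ᶜ coupleᶜ (var (# 0)) (const 0) ×ᶜ wk y ≡ᶜ sucᶜ (var (# 0))))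
        ⊎ᶜ ∃<ᶜ s (wk e ≡ᶜ coupleᶜ (const 2) (var (# 0)) ×ᶜ fact (const 2) (var (# 2)) (var (# 0)) (var (# 3)) (var (# 4)) (var (# 5)))
        ⊎ᶜ ∃<ᶜ s (∃<ᶜ (var (# 5)) (∃<ᶜ (var (# 6))
             (var (# 3) ≡ᶜ coupleᶜ (const 3) (coupleᶜ (var (# 2)) (var (# 1)))
              ×ᶜ fact (const 1) (var (# 1)) (var (# 4)) (var (# 0)) (var (# 6)) (var (# 7))
              ×ᶜ fact (const 0) (var (# 2)) (var (# 0)) (var (# 5)) (var (# 6)) (var (# 7)))))
        ⊎ᶜ ∃<ᶜ s (∃<ᶜ (var (# 5)) (∃<ᶜ (var (# 6))
             (var (# 3) ≡ᶜ coupleᶜ (const 4) (coupleᶜ (var (# 2)) (var (# 1)))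
              ×ᶜ var (# 4) ≡ᶜ coupleᶜ (const 0) (var (# 0))
              ×ᶜ fact (const 3) (var (# 1)) (const 0) (const 0) (var (# 6)) (var (# 7))
              ×ᶜ fact (const 0) (var (# 2)) (var (# 0)) (var (# 5)) (var (# 6)) (var (# 7)))))
        ⊎ᶜ ∃<ᶜ s (∃<ᶜ (var (# 5)) (∃<ᶜ (var (# 6)) (∃<ᶜ (var (# 7)) (∃<ᶜ (var (# 8))
             (var (# 5) ≡ᶜ coupleᶜ (const 4) (coupleᶜ (var (# 4)) (var (# 3)))
              ×ᶜ var (# 6) ≡ᶜ coupleᶜ (sucᶜ (var (# 1))) (var (# 2))
              ×ᶜ fact (const 0) (var (# 5)) (coupleᶜ (var (# 1)) (var (# 2))) (var (# 0)) (var (# 8)) (var (# 9))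
              ×ᶜ fact (const 0) (var (# 3)) (coupleᶜ (var (# 1)) (coupleᶜ (var (# 0)) (var (# 2)))) (var (# 7)) (var (# 8)) (var (# 9)))))))
        ⊎ᶜ ∃<ᶜ s (var (# 1) ≡ᶜ coupleᶜ (const 5) (var (# 0))
              ×ᶜ fact (const 0) (var (# 0)) (coupleᶜ (var (# 3)) (var (# 2))) (const 0) (var (# 4)) (var (# 5))
              ×ᶜ ∀<ᶜ (var (# 3)) (∃<ᶜ (var (# 6))
                   (fact (const 0) (var (# 2)) (coupleᶜ (var (# 1)) (var (# 4))) (sucᶜ (var (# 0))) (var (# 6)) (var (# 7)))))
        ⊎ᶜ (e ≡ᶜ coupleᶜ (const 6) (const 0) ×ᶜ ∃<ᶜ s (wk xs ≡ᶜ coupleᶜ (var (# 0)) (const 0) ×ᶜ wk y ≡ᶜ const 0))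
        where
        e  = var {O} {5} (# 0)
        xs = var {O} {5} (# 1)
        y  = var {O} {5} (# 2)
        s  = var {O} {5} (# 4)

      evalAllRuleᶜ : CP O 5 (λ { (gs , xs , ys , t , s , _) → EvalAllRule s (holds (entry t s)) gs xs ys })
      evalAllRuleᶜ =
          (var (# 0) ≡ᶜ const 0 ×ᶜ var (# 2) ≡ᶜ const 0)
        ⊎ᶜ ∃<ᶜ (var (# 4)) (∃<ᶜ (var (# 5)) (∃<ᶜ (var (# 6)) (∃<ᶜ (var (# 7))
             (var (# 4) ≡ᶜ coupleᶜ (var (# 3)) (var (# 2))
              ×ᶜ var (# 6) ≡ᶜ coupleᶜ (var (# 1)) (var (# 0))
              ×ᶜ fact (const 0) (var (# 3)) (var (# 5)) (var (# 1)) (var (# 7)) (var (# 8))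
              ×ᶜ fact (const 1) (var (# 2)) (var (# 5)) (var (# 0)) (var (# 7)) (var (# 8))))))

      nthRuleᶜ : CP O 5 (λ { (xs , i , y , t , s , _) → NthRule s (holds (entry t s)) xs i y })
      nthRuleᶜ =
          ∃<ᶜ (var (# 4)) (var (# 1) ≡ᶜ coupleᶜ (var (# 3)) (var (# 0)) ×ᶜ var (# 2) ≡ᶜ const 0)
        ⊎ᶜ ∃<ᶜ (var (# 4)) (∃<ᶜ (var (# 5)) (∃<ᶜ (var (# 6))
             (var (# 3) ≡ᶜ coupleᶜ (var (# 2)) (var (# 1))
              ×ᶜ var (# 4) ≡ᶜ sucᶜ (var (# 0))
              ×ᶜ fact (const 2) (var (# 1)) (var (# 0)) (var (# 5)) (var (# 6)) (var (# 7)))))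

      isCode isCodes : ∀ {n x t s} → Comp O n x → Comp O n t → Comp O n s → CP O n _
      isCode  x = fact (const 3) x (const 0) (const 0)
      isCodes x = fact (const 4) x (const 0) (const 0)

      codeRuleᶜ : CP O 3 (λ { (n , t , s , _) → CodeRule s (holds (entry t s)) n })
      codeRuleᶜ =
          var (# 0) ≡ᶜ coupleᶜ (const 0) (const 0)
        ⊎ᶜ var (# 0) ≡ᶜ coupleᶜ (const 1) (const 0)
        ⊎ᶜ ∃<ᶜ (var (# 2)) (var (# 1) ≡ᶜ coupleᶜ (const 2) (var (# 0)))
        ⊎ᶜ ∃<ᶜ (var (# 2)) (∃<ᶜ (var (# 3)) (var (# 2) ≡ᶜ coupleᶜ (const 3) (coupleᶜ (var (# 1)) (var (# 0)))
             ×ᶜ isCode (var (# 1)) (var (# 3)) (var (# 4)) ×ᶜ isCodes (var (# 0)) (var (# 3)) (var (# 4))))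
        ⊎ᶜ ∃<ᶜ (var (# 2)) (∃<ᶜ (var (# 3)) (var (# 2) ≡ᶜ coupleᶜ (const 4) (coupleᶜ (var (# 1)) (var (# 0)))
             ×ᶜ isCode (var (# 1)) (var (# 3)) (var (# 4)) ×ᶜ isCode (var (# 0)) (var (# 3)) (var (# 4))))
        ⊎ᶜ ∃<ᶜ (var (# 2)) (var (# 1) ≡ᶜ coupleᶜ (const 5) (var (# 0)) ×ᶜ isCode (var (# 0)) (var (# 2)) (var (# 3)))
        ⊎ᶜ var (# 0) ≡ᶜ coupleᶜ (const 6) (const 0)

      codesRuleᶜ : CP O 3 (λ { (n , t , s , _) → CodesRule s (holds (entry t s)) n })
      codesRuleᶜ =
          var (# 0) ≡ᶜ const 0
        ⊎ᶜ ∃<ᶜ (var (# 2)) (∃<ᶜ (var (# 3)) (var (# 2) ≡ᶜ coupleᶜ (var (# 1)) (var (# 0))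
             ×ᶜ isCode (var (# 1)) (var (# 3)) (var (# 4)) ×ᶜ isCodes (var (# 0)) (var (# 3)) (var (# 4))))

      ruleᶜ : CP O 6 rule
      ruleᶜ =
          (var (# 0) ≡ᶜ const 0 ×ᶜ callᴾ evalRuleᶜ (drop 1))
        ⊎ᶜ (var (# 0) ≡ᶜ const 1 ×ᶜ callᴾ evalAllRuleᶜ (drop 1))
        ⊎ᶜ (var (# 0) ≡ᶜ const 2 ×ᶜ callᴾ nthRuleᶜ (drop 1))
        ⊎ᶜ (var (# 0) ≡ᶜ const 3 ×ᶜ callᴾ codeRuleᶜ (var (# 1) ∷ᵃ drop 4))
        ⊎ᶜ (var (# 0) ≡ᶜ const 4 ×ᶜ callᴾ codesRuleᶜ (var (# 1) ∷ᵃ drop 4))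

    factᶜ : ∀ {n s k a b c} → Comp O n s → Comp O n k → Comp O n a → Comp O n b → Comp O n c →
            CP O n (λ w → Fact (s w) (k w) (a w) (b w) (c w))
    factᶜ s k a b c =
      call (It.stageᶜ derivableᶜ) (coupleᶜ k (coupleᶜ a (coupleᶜ b c)) ∷ᵃ s ∷ᵃ []ᵃ) ≡ᶜ const 1
      where
      derivableᶜ : Comp O 3 (λ { (z , t , s , w) → derivable w s (entry t s) z })
      derivableᶜ = indicator (callᴾ ruleᶜ (π₁ᶜ (var (# 0)) ∷ᵃ π₁ᶜ (π₂ᶜ (var (# 0)))
        ∷ᵃ π₁ᶜ (π₂ᶜ (π₂ᶜ (var (# 0)))) ∷ᵃ π₂ᶜ (π₂ᶜ (π₂ᶜ (var (# 0)))) ∷ᵃ drop 1))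

  -- Kraft's inequality and Shannon–Fano codes

  -- The measure of the cone above a string, multiplied by 2 ^ c to stay within ℕ. For `n < c` the
  -- subtraction is exact, as `len n ≤ n`.
  weight : ℕ → (ℕ → Set) → ℕ → ℕ
  weight c A n = χ (A n) * 2 ^ (c ∸ len n)

  weight-yes : ∀ {c} {A : ℕ → Set} {n} → A n → weight c A n ≡ 2 ^ (c ∸ len n)
  weight-yes a = trans (cong (_* _) (χ-yes a)) (+-identityʳ _)

  weight-no : ∀ {c} {A : ℕ → Set} {n} → ¬ A n → weight c A n ≡ 0
  weight-no ¬a = cong (_* _) (χ-no ¬a)

  Antichain : (Str → Set) → Set
  Antichain A = ∀ ρ σ → A ρ → A (ρ ++ σ) → σ ≡ []

  -- Induction on the depth. If the root is in `A`, nothing else is; if not, `A` restricts to an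
  -- antichain in each of the two subtrees, and each contributes at most half.
  kraft-tree : ∀ n (A : Str → Set) → Antichain A → sum< (fullTree n) (weight n (λ z → A (decode z))) ≤ 2 ^ n
  kraft-tree zero A pf = ≤-trans (≤-reflexive (+-identityʳ _)) (≤-trans (≤-reflexive (*-identityʳ _)) (χ≤1 _))
  kraft-tree (suc n) A pf = ≤-trans (≤-reflexive (sum<-double N f)) (by-cases (A []) root noRoot)
    where
    N = fullTree n
    f = weight (suc n) (λ z → A (decode z))
    left right : ℕ → ℕ
    left  z = f (suc (2 * z))
    right z = f (suc (suc (2 * z)))
    root : A [] → f 0 + sum< N (λ i → left i + right i) ≤ 2 ^ suc n
    root a = ≤-reflexive (trans (cong₂ _+_ (weight-yes {suc n} {λ z → A (decode z)} {0} a)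
        (sum<-zero N (λ i _ → cong₂ _+_ (off (decode-odd i)) (off (decode-even i))))) (+-identityʳ _))
      where
      off : ∀ {z b s} → decode z ≡ b ∷ s → f z ≡ 0
      off {z} eq = weight-no {suc n} {λ z → A (decode z)} {z} (λ a′ → non-empty eq (pf [] (decode z) a a′))
        where
        non-empty : ∀ {z b s} → decode z ≡ b ∷ s → decode z ≢ []
        non-empty eq eq′ with trans (sym eq) eq′
        ... | ()
    noRoot : ¬ A [] → f 0 + sum< N (λ i → left i + right i) ≤ 2 ^ suc n
    noRoot ¬a = ≤-trans (≤-reflexive (cong₂ _+_ (weight-no {suc n} {λ z → A (decode z)} {0} ¬a) (sum<-+ N left right)))
      (≤-trans (+-mono-≤ (half false decode-odd) (half true decode-even))
        (≤-reflexive (cong (2 ^ n +_) (sym (+-identityʳ _)))))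
      where
      half : ∀ b {g : ℕ → ℕ} → (∀ z → decode (g z) ≡ b ∷ decode z) → sum< N (λ z → f (g z)) ≤ 2 ^ n
      half b {g} eq = ≤-trans (≤-reflexive (sum<-cong N (λ z _ → cong (λ s → χ (A s) * 2 ^ (suc n ∸ length s)) (eq z))))
        (kraft-tree n (λ s → A (b ∷ s)) (λ ρ σ → pf (b ∷ ρ) σ))

  kraft : ∀ c (A : Str → Set) → Antichain A → sum< c (weight c (λ z → A (decode z))) ≤ 2 ^ c
  kraft c A pf = ≤-trans (sum<-monoˡ _ (<⇒≤ (n<fullTree c))) (kraft-tree c A pf)

  sum<-χ≡ : ∀ m (B : Set) x → sum< m (λ j → χ (B × x ≡ j)) ≤ χ B
  sum<-χ≡ m B x = by-cases B
    (λ b → ≤-trans (at-most-one m) (≤-reflexive (sym (χ-yes b))))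
    (λ ¬b → ≤-trans (≤-reflexive (sum<-zero m (λ i _ → χ-no (λ p → ¬b (proj₁ p))))) z≤n)
    where
    at-most-one : ∀ m → sum< m (λ j → χ (B × x ≡ j)) ≤ 1
    at-most-one zero    = z≤n
    at-most-one (suc m) = by-cases (B × x ≡ m)
      (λ { (_ , refl) → +-mono-≤ (χ≤1 (B × x ≡ x))
              (≤-reflexive (sum<-zero x {λ j → χ (B × x ≡ j)} (λ i i<x → χ-no (λ p → <⇒≢ i<x (sym (proj₂ p)))))) })
      (λ ¬p → ≤-trans (≤-reflexive (cong (_+ sum< m (λ j → χ (B × x ≡ j))) (χ-no ¬p))) (at-most-one m))

  -- Averaging: the m classes are disjoint, so if each weighed more than 2 ^ c / m, together they
  -- would exceed the total.
  light-colour : ∀ c m (B : ℕ → Set) (colour : ℕ → ℕ) → 0 < m → sum< c (weight c B) ≤ 2 ^ c →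
                 ∃ λ j → j < m × m * sum< c (weight c (λ z → B z × colour z ≡ j)) ≤ 2 ^ c
  light-colour c m B colour 0<m total = ¬¬-elim (λ none → <⇒≱ (strict none) bounded)
    where
    W : ℕ → ℕ
    W j = sum< c (weight c (λ z → B z × colour z ≡ j))
    bounded : sum< m (λ j → m * W j) ≤ m * 2 ^ c
    bounded = ≤-trans (≤-reflexive (sum<-* m m W)) (*-monoʳ-≤ m (≤-trans
      (≤-reflexive (sum<-swap m c _))
      (≤-trans (sum<-mono c (λ z _ → ≤-trans
        (≤-reflexive (trans (sum<-cong m (λ j _ → *-comm (χ (B z × colour z ≡ j)) (2 ^ (c ∸ len z))))
          (trans (sum<-* m (2 ^ (c ∸ len z)) (λ j → χ (B z × colour z ≡ j))) (*-comm (2 ^ (c ∸ len z)) _))))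
        (*-monoˡ-≤ (2 ^ (c ∸ len z)) (sum<-χ≡ m (B z) (colour z))))) total)))
    strict : ¬ (∃ λ j → j < m × m * W j ≤ 2 ^ c) → m * 2 ^ c < sum< m (λ j → m * W j)
    strict none = <-≤-trans (*-monoʳ-< m {{>-nonZero 0<m}} (n<1+n (2 ^ c)))
      (≤-trans (≤-reflexive (sym (sum<-const m (suc (2 ^ c)))))
        (sum<-mono m (λ j j<m → ≰⇒> (λ le → none (j , j<m , le)))))

  offset : ℕ → (ℕ → Set) → ℕ → ℕ
  offset c A y = sum< y (weight c A)

  -- The dyadic interval of w is the share of y in the cumulative weights of A,
  -- blown up by the factor 2 ^ r.
  Codeword : ℕ → ℕ → (ℕ → Set) → ℕ → Str → Set
  Codeword c r A y w = length w + r ≡ len y × val w * 2 ^ (c ∸ len y) ≡ offset c A y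

  -- The codeword is the offset of `y` divided by the weight of `y`, written with `len y ∸ r` bits.
  -- The division is exact: elements numbered before `y` are no longer than `y`, so their weights
  -- are multiples of its weight.
  codeword-exists : ∀ {c r A y} → y < c → A y → 2 ^ r * sum< c (weight c A) ≤ 2 ^ c → ∃ (Codeword c r A y)
  codeword-exists {c} {r} {A} {y} y<c a light = found (sum<-∣ y (weight c A) aligned)
    where
    l = len y
    u = 2 ^ (c ∸ l)
    l≤c : l ≤ c
    l≤c = ≤-trans (len≤ y) (<⇒≤ y<c)
    instance _ = >-nonZero (0<2^n (c ∸ l))
    instance _ = >-nonZero (0<2^n r)
    aligned : ∀ i → i < y → u ∣ weight c A i
    aligned i i<y = ∣n⇒∣m*n (χ (A i)) (divides (2 ^ (l ∸ len i))
      (trans (cong (2 ^_) (trans (cong (_∸ len i) (sym (m∸n+n≡m l≤c))) (+-∸-assoc (c ∸ l) (len-mono (<⇒≤ i<y)))))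
        (trans (^-distribˡ-+-* 2 (c ∸ l) (l ∸ len i)) (*-comm u _))))
    -- The share of `y` ends within the total weight. Both `r ≤ l` and the bound on the quotient
    -- come from this.
    room : 2 ^ r * (u + offset c A y) ≤ 2 ^ c
    room = ≤-trans (*-monoʳ-≤ (2 ^ r) (≤-trans
      (≤-reflexive (cong (_+ offset c A y) (sym (weight-yes {c} {A} a)))) (sum<-monoˡ {suc y} (weight c A) y<c))) light
    r≤l : r ≤ l
    r≤l = +-cancelʳ-≤ (c ∸ l) r l (≤-trans (2^-cancel-≤ (≤-trans (≤-reflexive (^-distribˡ-+-* 2 r (c ∸ l)))
      (≤-trans (*-monoʳ-≤ (2 ^ r) (m≤m+n u _)) room))) (≤-reflexive (sym (m+[n∸m]≡n l≤c))))
    found : u ∣ offset c A y → ∃ (Codeword c r A y)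
    found (divides q eq) with val-surjective (l ∸ r) q
      (*-cancelʳ-≤ (suc q) (2 ^ (l ∸ r)) u (*-cancelˡ-≤ (2 ^ r) (≤-trans
        (≤-reflexive (cong (λ x → 2 ^ r * (u + x)) (sym eq)))
        (≤-trans room (≤-reflexive (trans (2^-split l≤c) (trans (cong (_* u) (2^-split r≤l)) (*-assoc (2 ^ r) _ u))))))))
    ... | w , |w| , vw = w , trans (cong (_+ r) |w|) (m∸n+n≡m r≤l) , trans (cong (_* u) vw) (sym eq)

  offset-step : ∀ {c A y z} → A y → y < z → offset c A y + 2 ^ (c ∸ len y) ≤ offset c A z
  offset-step {c} {A} {y} a y<z = ≤-trans
    (≤-reflexive (trans (+-comm (offset c A y) _) (cong (_+ offset c A y) (sym (weight-yes {c} {A} a)))))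
    (sum<-monoˡ {suc y} (weight c A) y<z)

  -- If one codeword extends the other, the offset of `z` falls into the share of `y`, between
  -- `lower` and `upper`. Shares of different elements are disjoint, so `z` is `y`, and comparing
  -- lengths leaves nothing for `σ`.
  codeword-prefixFree : ∀ {c r A y z w} σ → y < c → z < c → A y → A z →
                        Codeword c r A y w → Codeword c r A z (w ++ σ) → y ≡ z × σ ≡ []
  codeword-prefixFree {c} {r} {A} {y} {z} {w} σ y<c z<c ay az (lw , vw) (lwσ , vwσ) = cases (<-cmp y z)
    where
    length≡0 : ∀ (σ : Str) → length σ ≡ 0 → σ ≡ []
    length≡0 [] refl = refl
    len-z : len z ≡ len y + length σ
    len-z = trans (sym lwσ) (trans (cong (_+ r) (length-++ w)) (trans (+-assoc (length w) _ r)
      (trans (cong (length w +_) (+-comm (length σ) r)) (trans (sym (+-assoc (length w) r _)) (cong (_+ length σ) lw)))))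
    uy = 2 ^ (c ∸ len y)
    uz = 2 ^ (c ∸ len z)
    split : uy ≡ 2 ^ length σ * uz
    split = trans (2^-split {c ∸ len y} {length σ} (m+n≤o⇒m≤o∸n _
        (≤-trans (≤-reflexive (trans (+-comm _ (len y)) (sym len-z))) (≤-trans (len≤ z) (<⇒≤ z<c)))))
      (cong (λ k → 2 ^ length σ * 2 ^ k) (trans (∸-+-assoc c (len y) (length σ)) (cong (c ∸_) (sym len-z))))
    lower : offset c A y ≤ offset c A z
    lower = ≤-trans (≤-reflexive (trans (sym vw) (trans (cong (val w *_) split) (sym (*-assoc (val w) _ uz)))))
      (≤-trans (*-monoˡ-≤ uz (≤-trans (m≤m+n _ (val σ)) (≤-reflexive (sym (val-++ w σ))))) (≤-reflexive vwσ))
    upper : offset c A z < offset c A y + uy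
    upper = ≤-<-trans (≤-reflexive (trans (sym vwσ) (trans (cong (_* uz) (val-++ w σ)) (*-distribʳ-+ uz (val w * 2 ^ length σ) (val σ)))))
      (<-≤-trans (+-monoʳ-< (val w * 2 ^ length σ * uz) (*-monoˡ-< uz {{>-nonZero (0<2^n (c ∸ len z))}} (val< σ)))
        (≤-reflexive (cong₂ _+_ (trans (*-assoc (val w) _ uz) (trans (cong (val w *_) (sym split)) vw)) (sym split))))
    cases : _ → y ≡ z × σ ≡ []
    cases (tri< y<z _ _) = ⊥-elim (<⇒≱ upper (offset-step {c} {A} ay y<z))
    cases (tri> _ _ z<y) =
      ⊥-elim (<⇒≱ (<-≤-trans (m<m+n (offset c A z) (0<2^n (c ∸ len z))) (offset-step {c} {A} az z<y)) lower)
    cases (tri≈ _ y≡z _) = y≡z , length≡0 σ (+-cancelˡ-≡ (len y) _ _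
      (trans (sym len-z) (trans (cong len (sym y≡z)) (sym (+-identityʳ _)))))

  -- Computability of lengths and binary values

  lenᶜ : ∀ {O n f} → Comp O n f → Comp O n (λ v → len (f v))
  lenᶜ a = call (graphᶜ (λ v → len (proj₁ v)) (var zero) (λ v → len≤ (proj₁ v)) (iffᶜ
      (λ v h → len-unique (proj₁ (proj₂ v)) (proj₁ v) (proj₁ h) (proj₂ h))
      (λ { (_ , n , _) refl → 2^len≤ n , <2^len n })
      (2^ᶜ var zero ≤ᶜ sucᶜ (var (suc zero)) ×ᶜ sucᶜ (var (suc zero)) <ᶜ 2^ᶜ sucᶜ (var zero)))) (a ∷ᵃ []ᵃ)

  private
    -- Recursion along a string in terms of its number `x`: its tail is the only `z` for which `x`
    -- is 2 z + 1 or 2 z + 2, and the indicators select it together with the leading bit.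
    digits : Env 0 → ℕ → (ℕ → ℕ) → ℕ
    digits _ x h = sum< x (λ z → χ (x ≡ suc (2 * z)) * h z + χ (x ≡ suc (suc (2 * z))) * (2 ^ len z + h z))

    module V = CourseOfValues digits

    value≡val : ∀ x → V.value tt x ≡ val (decode x)
    value≡val = <-rec _ go
      where
      go : ∀ x → (∀ {z} → z < x → V.value tt z ≡ val (decode z)) → V.value tt x ≡ val (decode x)
      go zero    rec = V.value≡ tt 0
      go (suc x) rec with parityView x
      ... | even q = trans (V.value≡ tt _) (trans (sum<-single _ q<x others)
            (trans (cong₂ _+_ (trans (cong (_* h q) (χ-yes refl)) (+-identityʳ _))
                              (cong (_* (2 ^ len q + h q)) (χ-no (λ eq → even≢odd q q (suc-injective eq)))))
              (trans (+-identityʳ _) (trans (V.stage≡value tt q<x) (trans (rec q<x) (cong val (sym (decode-odd q))))))))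
        where
        h = V.stage tt (suc (2 * q))
        q<x : q < suc (2 * q)
        q<x = s≤s (m≤m+n q _)
        others : ∀ j → j < suc (2 * q) → j ≢ q → _
        others j _ j≢q = cong₂ _+_
          (cong (_* h j) (χ-no (λ eq → j≢q (sym (*-cancelˡ-≡ q j 2 (suc-injective eq))))))
          (cong (_* (2 ^ len j + h j)) (χ-no (λ eq → even≢odd q j (suc-injective eq))))
      ... | odd q = trans (V.value≡ tt _) (trans (sum<-single _ q<x others)
            (trans (cong₂ _+_ (cong (_* h q) (χ-no (λ eq → even≢odd q q (sym (suc-injective eq)))))
                              (trans (cong (_* (2 ^ len q + h q)) (χ-yes refl)) (+-identityʳ _)))
              (trans (cong (2 ^ len q +_) (trans (V.stage≡value tt q<x) (rec q<x))) (cong val (sym (decode-even q))))))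
        where
        h = V.stage tt (suc (suc (2 * q)))
        q<x : q < suc (suc (2 * q))
        q<x = s≤s (≤-trans (m≤m+n q _) (n≤1+n _))
        others : ∀ j → j < suc (suc (2 * q)) → j ≢ q → _
        others j _ j≢q = cong₂ _+_
          (cong (_* h j) (χ-no (λ eq → even≢odd j q (sym (suc-injective eq)))))
          (cong (_* (2 ^ len j + h j)) (χ-no (λ eq → j≢q (sym (*-cancelˡ-≡ q j 2 (suc-injective (suc-injective eq)))))))

  valᶜ : ∀ {O n f} → Comp O n f → Comp O n (λ v → val (decode (f v)))
  valᶜ {f = f} a = ext (λ v → value≡val (f v)) (call (V.valueᶜ digitsᶜ) (a ∷ᵃ []ᵃ))
    where
    digitsᶜ : ∀ {O} → Comp O 2 (λ { (t , x , v) → digits v x (entry t x) })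
    digitsᶜ = sumᶜ (var (# 1))
      (indicator (var (# 2) ≡ᶜ sucᶜ (const 2 *ᶜ var (# 0))) *ᶜ entryᶜ (var (# 1)) (var (# 2)) (var (# 0))
       +ᶜ indicator (var (# 2) ≡ᶜ sucᶜ (sucᶜ (const 2 *ᶜ var (# 0))))
          *ᶜ (2^ᶜ lenᶜ (var (# 0)) +ᶜ entryᶜ (var (# 1)) (var (# 2)) (var (# 0))))

  -- R is the matrix of a Σ⁰₂ definition.  Colour j is held at stage x with age at
  -- most t if some y ≤ t of that colour has a witness a ≤ t not refuted before x.
  -- Colours met by the set defined by R are eventually held with bounded age, the
  -- other colours are not; so giving x the most weakly held colour makes the set meet
  -- every colour.
  module Colouring (R : ℕ → ℕ → ℕ → Set) where
    private
      Held : ℕ → (ℕ → ℕ) → ℕ → ℕ → Set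
      Held x h j t = ∃ λ y → y < x × h y ≡ j × y ≤ t × ∃ λ a → a < suc t × (∀ b → b < x → R y a b)

      SomeFree : ℕ → ℕ → (ℕ → ℕ) → ℕ → Set
      SomeFree m x h t = ∃ λ j → j < m × ¬ Held x h j t

      firstFree : ℕ → ℕ → (ℕ → ℕ) → ℕ → ℕ
      firstFree m x h t = sum< m (λ j → j * χ (¬ Held x h j t × (∀ i → i < j → Held x h i t)))

      -- Later successes overwrite earlier ones, so the result belongs to the largest age at which
      -- some colour is free; 0 is returned if there is no such age.
      pick : ℕ → ℕ → (ℕ → ℕ) → ℕ → ℕ
      pick m x h = natrec 0 (λ t p → χ (SomeFree m x h t) * firstFree m x h t + χ (¬ SomeFree m x h t) * p)

      choose : Env 1 → ℕ → (ℕ → ℕ) → ℕ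
      choose (m , _) x h = pick m x h x

      module C = CourseOfValues choose

      firstFree-free : ∀ m x h t → SomeFree m x h t → firstFree m x h t < m × ¬ Held x h (firstFree m x h t) t
      firstFree-free m x h t (j , j<m , ¬held) with least {λ j → ¬ Held x h j t} ¬held
      ... | i , ¬heldᵢ , first = subst (λ k → k < m × ¬ Held x h k t) (sym eq) (≤-<-trans i≤j j<m , ¬heldᵢ)
        where
        i≤j : i ≤ j
        i≤j = ≮⇒≥ (λ j<i → first j j<i ¬held)
        eq : firstFree m x h t ≡ i
        eq = trans (sum<-single _ (≤-<-trans i≤j j<m) others)
          (trans (cong (i *_) (χ-yes (¬heldᵢ , λ k k<i → ¬¬-elim (first k k<i)))) (*-identityʳ i))
          where
          others : ∀ k → k < m → k ≢ i → k * χ (¬ Held x h k t × (∀ l → l < k → Held x h l t)) ≡ 0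
          others k _ k≢i = trans (cong (k *_) (χ-no wrong)) (*-zeroʳ k)
            where
            wrong : ¬ (¬ Held x h k t × (∀ l → l < k → Held x h l t))
            wrong (¬heldₖ , below) with <-cmp k i
            ... | tri< k<i _ _ = first k k<i ¬heldₖ
            ... | tri≈ _ k≡i _ = k≢i k≡i
            ... | tri> _ _ i<k = ¬heldᵢ (below i i<k)

      pick-free : ∀ m x h t → SomeFree m x h t → pick m x h (suc t) ≡ firstFree m x h t
      pick-free m x h t free = trans (cong₂ _+_
        (trans (cong (_* firstFree m x h t) (χ-yes free)) (+-identityʳ _))
        (cong (_* pick m x h t) (χ-no (λ ¬free → ¬free free)))) (+-identityʳ _)

      pick-held : ∀ m x h t → ¬ SomeFree m x h t → pick m x h (suc t) ≡ pick m x h t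
      pick-held m x h t ¬free = cong₂ _+_
        (cong (_* firstFree m x h t) (χ-no ¬free))
        (trans (cong (_* pick m x h t) (χ-yes ¬free)) (+-identityʳ _))

      -- Since a colour is free at `t₀`, the value picked stems from an age at least `t₀`, and at
      -- such ages only unmet colours are free.
      pick-unmet : ∀ m x h t₀ (Met : ℕ → Set) → SomeFree m x h t₀ →
                   (∀ t j → t₀ ≤ t → j < m → ¬ Held x h j t → ¬ Met j) →
                   ∀ t → t₀ < t → ¬ Met (pick m x h t)
      pick-unmet m x h t₀ Met free free⇒unmet (suc t) (s≤s t₀≤t) = by-cases (SomeFree m x h t)
        (λ some → subst (λ j → ¬ Met j) (sym (pick-free m x h t some))
           (free⇒unmet t _ t₀≤t (proj₁ (firstFree-free m x h t some)) (proj₂ (firstFree-free m x h t some))))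
        (λ ¬some → subst (λ j → ¬ Met j) (sym (pick-held m x h t ¬some)) (earlier ¬some (m≤n⇒m<n∨m≡n t₀≤t)))
        where
        earlier : ¬ SomeFree m x h t → t₀ < t ⊎ t₀ ≡ t → ¬ Met (pick m x h t)
        earlier ¬some (inj₁ t₀<t) = pick-unmet m x h t₀ Met free free⇒unmet t t₀<t
        earlier ¬some (inj₂ refl) = ⊥-elim (¬some free)

    colour : ℕ → ℕ → ℕ
    colour m = C.value (m , tt)

    module _ (A : ℕ → Set)
      (A⇒ : ∀ y → A y → ∃ λ a → ∀ b → R y a b)
      (⇒A : ∀ y → (∃ λ a → ∀ b → R y a b) → A y)
      (A-infinite : ∀ n → ∃ λ y → n ≤ y × A y) where

      -- If `j₀` were unmet, all sufficiently large numbers would receive unmet colours. But `A` has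
      -- arbitrarily large elements, and each of them meets its own colour.
      colour-surjective : ∀ m j → j < m → ∃ λ y → A y × colour m y ≡ j
      colour-surjective m j₀ j₀<m = ¬¬-elim missed-impossible
        where
        Met : ℕ → Set
        Met j = ∃ λ y → A y × colour m y ≡ j

        Witnessed : ℕ → ℕ → Set
        Witnessed t j = Met j → ∃ λ y → y ≤ t × colour m y ≡ j × ∃ λ a → a ≤ t × (∀ b → R y a b)

        witnessed : ∀ j → Eventually (λ t → Witnessed t j)
        witnessed j = by-cases (Met j)
          (λ { (y , Ay , eq) → let a , r = A⇒ y Ay in
               y ⊔ a , λ t le _ → y , m⊔n≤o⇒m≤o y a le , eq , a , m⊔n≤o⇒n≤o y a le , r })
          (λ ¬met → always (λ t met → ⊥-elim (¬met met)))

        bound = eventually-∀ {Witnessed} m (λ j _ → witnessed j)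
        t₀ = proj₁ bound

        Refuted : ℕ → ℕ → ℕ → Set
        Refuted x y a = colour m y ≡ j₀ → ∃ λ b → b < x × ¬ R y a b

        -- A number whose colour is unmet lies outside `A`, so each of its candidate witnesses `a`
        -- fails at some `b`.
        refuted : ¬ Met j₀ → ∀ y a → Eventually (λ x → Refuted x y a)
        refuted ¬met y a = by-cases (colour m y ≡ j₀)
          (λ eq → let b , ¬r = ¬∀⇒∃¬ (λ r → ¬met (y , ⇒A y (a , r) , eq)) in
                  suc b , λ x b<x _ → b , b<x , ¬r)
          (λ ¬eq → always (λ x eq → ⊥-elim (¬eq eq)))

        late-unmet : ∀ x → t₀ < x → (∀ y → y < suc t₀ → ∀ a → a < suc t₀ → Refuted x y a) → ¬ Met (colour m x)
        late-unmet x t₀<x refuted =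
          subst (λ j → ¬ Met j) (sym (C.value≡ (m , tt) x)) (pick-unmet m x h t₀ Met free free⇒unmet x t₀<x)
          where
          h = C.stage (m , tt) x
          h≡ : ∀ {y} → y < x → h y ≡ colour m y
          h≡ = C.stage≡value (m , tt)

          -- Only finitely many pairs `y`, `a` up to `t₀` could hold `j₀` at this age, and by stage
          -- `x` all of them have been refuted.
          free : SomeFree m x h t₀
          free = j₀ , j₀<m , λ { (y , y<x , eq , y≤t₀ , a , a<1+t₀ , r) →
            let b , b<x , ¬r = refuted y (s≤s y≤t₀) a a<1+t₀ (trans (sym (h≡ y<x)) eq) in ¬r (r b b<x) }

          free⇒unmet : ∀ t j → t₀ ≤ t → j < m → ¬ Held x h j t → ¬ Met j
          free⇒unmet t j t₀≤t j<m ¬held met =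
            let y , y≤t₀ , eq , a , a≤t₀ , r = proj₂ bound t₀ ≤-refl j j<m met
                y<x = ≤-<-trans y≤t₀ t₀<x
            in ¬held (y , y<x , trans (h≡ y<x) eq , ≤-trans y≤t₀ t₀≤t , a , s≤s (≤-trans a≤t₀ t₀≤t) , λ b _ → r b)

        missed-impossible : ¬ ¬ Met j₀
        missed-impossible ¬met = conclude
          (eventually-∀ {λ x y → ∀ a → a < suc t₀ → Refuted x y a} (suc t₀)
             (λ y _ → eventually-∀ {λ x a → Refuted x y a} (suc t₀) (λ a _ → refuted ¬met y a))
           ⊗ eventually-< t₀)
          where
          conclude : Eventually (λ x → (∀ y → y < suc t₀ → ∀ a → a < suc t₀ → Refuted x y a) × t₀ < x) → ⊥
          conclude (n , late) = let x , n≤x , Ax = A-infinite n in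
            late-unmet x (proj₂ (late x n≤x)) (proj₁ (late x n≤x)) (x , Ax , refl)

    colourᶜ : ∀ {O n f g} → CP O 3 (λ { (y , a , b , _) → R y a b }) →
              Comp O n f → Comp O n g → Comp O n (λ v → colour (f v) (g v))
    colourᶜ {O} Rᶜ m x = call (C.valueᶜ chooseᶜ) (x ∷ᵃ m ∷ᵃ []ᵃ)
      where
      heldᶜ : CP O 4 (λ { (j , t , T , x , _) → Held x (entry T x) j t })
      heldᶜ = ∃<ᶜ (var (# 3))
        (entryᶜ (var (# 3)) (var (# 4)) (var (# 0)) ≡ᶜ var (# 1)
         ×ᶜ var (# 0) ≤ᶜ var (# 2)
         ×ᶜ ∃<ᶜ (sucᶜ (var (# 2))) (∀<ᶜ (var (# 5)) (callᴾ Rᶜ (var (# 2) ∷ᵃ var (# 1) ∷ᵃ var (# 0) ∷ᵃ []ᵃ))))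
      someFreeᶜ : CP O 5 (λ { (t , p , T , x , m , _) → SomeFree m x (entry T x) t })
      someFreeᶜ = ∃<ᶜ (var (# 4)) (¬ᶜ (callᴾ heldᶜ (var (# 0) ∷ᵃ var (# 1) ∷ᵃ var (# 3) ∷ᵃ var (# 4) ∷ᵃ []ᵃ)))
      firstFreeᶜ : Comp O 5 (λ { (t , p , T , x , m , _) → firstFree m x (entry T x) t })
      firstFreeᶜ = sumᶜ (var (# 4)) (var (# 0) *ᶜ indicator
        (¬ᶜ (callᴾ heldᶜ (var (# 0) ∷ᵃ var (# 1) ∷ᵃ var (# 3) ∷ᵃ var (# 4) ∷ᵃ []ᵃ))
         ×ᶜ ∀<ᶜ (var (# 0)) (callᴾ heldᶜ (var (# 0) ∷ᵃ var (# 2) ∷ᵃ var (# 4) ∷ᵃ var (# 5) ∷ᵃ []ᵃ))))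
      chooseᶜ : Comp O 3 (λ { (T , x , v) → choose v x (entry T x) })
      chooseᶜ = recᶜ (const 0)
        (indicator someFreeᶜ *ᶜ firstFreeᶜ +ᶜ indicator (¬ᶜ someFreeᶜ) *ᶜ var (# 1)) (var (# 1))

  -- The reduction of the halting problem to S

  module Reduction (U : Code) (U-universal : UniversalPF U)
    (S : Str → Bool) (S⊆M_U : ∀ ρ → S ρ ≡ true → InMU U ρ) (S-infinite : Infinite S)
    (R : Code) (R-total : Total3 R)
    (S-definition : ∀ ρ →
      (S ρ ≡ true → Σ ℕ λ a → ∀ b → ∅O ⊢ R [ ⌜ ρ ⌝ ∷ a ∷ b ∷ [] ]⇓ 0) ×
      ((Σ ℕ λ a → ∀ b → ∅O ⊢ R [ ⌜ ρ ⌝ ∷ a ∷ b ∷ [] ]⇓ 0) → S ρ ≡ true)) where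

    Matrix : ℕ → ℕ → ℕ → Set
    Matrix y a b = proj₁ (R-total y a b) ≡ 0

    open Colouring Matrix

    matrixᶜ : CP ∅O 3 (λ { (y , a , b , _) → Matrix y a b })
    matrixᶜ = mkComp R (λ { (y , a , b , _) → proj₂ (R-total y a b) }) ≡ᶜ const 0

    InS : ℕ → Set
    InS y = S (decode y) ≡ true

    matrix⇔ : ∀ y a b → (∅O ⊢ R [ ⌜ decode y ⌝ ∷ a ∷ b ∷ [] ]⇓ 0 → Matrix y a b) ×
                        (Matrix y a b → ∅O ⊢ R [ ⌜ decode y ⌝ ∷ a ∷ b ∷ [] ]⇓ 0)
    matrix⇔ y a b rewrite ⌜decode⌝ y =
      (λ e → ⇓-deterministic (proj₂ (R-total y a b)) e) , (λ eq → ⇓-resp-≡ eq (proj₂ (R-total y a b)))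

    opaque
      every-colour-in-S : ∀ m j → j < m → ∃ λ y → InS y × colour m y ≡ j
      every-colour-in-S = colour-surjective InS
        (λ y s → let a , h = proj₁ (S-definition (decode y)) s in a , λ b → proj₁ (matrix⇔ y a b) (h b))
        (λ { y (a , h) → proj₂ (S-definition (decode y)) (a , λ b → proj₂ (matrix⇔ y a b) (h b)) })
        (λ n → let ρ , n≤ , s = S-infinite n in
           ⌜ ρ ⌝ , ≤-trans n≤ (s≤s⁻¹ (<-≤-trans (n<2^n (length ρ)) (2^length≤ ρ))) ,
           trans (cong S (decode-⌜⌝ ρ)) s)

    -- Quantifying over the stages below `c` makes the notion monotone in `c` at once. `couple x 0`
    -- is the coded argument list with the single entry `x`.
    ConvergesBy : ℕ → ℕ → ℕ → Set
    ConvergesBy c e x = ∃ λ s → s < c × ∃ λ v → v < s × Fact s 0 e (couple x 0) v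

    convergesBy-mono : ∀ {c d e x} → c ≤ d → ConvergesBy c e x → ConvergesBy d e x
    convergesBy-mono c≤d (s , s<c , rest) = s , <-≤-trans s<c c≤d , rest

    convergesBy-complete : ∀ {f x v} → ∅O ⊢ f [ x ∷ [] ]⇓ v → Eventually (λ c → ConvergesBy c (number f) x)
    convergesBy-complete {v = v} ev = let b , facts = eval-complete ev ⊗ eventually-< v in
      suc b , λ c b<c → b , b<c , v , proj₂ (facts b ≤-refl) , proj₁ (facts b ≤-refl)

    convergesBy-sound : ∀ {c e x} → ConvergesBy c e x → ∃ λ f → number f ≡ e × ∃ λ v → ∅O ⊢ f [ x ∷ [] ]⇓ v
    convergesBy-sound {x = x} (s , _ , v , _ , fact) with fact-sound s 0 _ _ _ fact
    ... | f , l , eq , eql , ev with encodeList-injective l (x ∷ []) eql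
    ... | refl = f , eq , v , ev

    EnteredBy : ℕ → ℕ → Set
    EnteredBy c k = ConvergesBy c k k

    enteredBy⇒halting : ∀ {c k} → EnteredBy c k → Halting k
    enteredBy⇒halting entered = let f , eq , v , ev = convergesBy-sound entered in
      f , trans (sym (number≡encode f)) eq , v , ev

    halting⇒enteredBy : ∀ {k} → Halting k → Eventually (λ c → EnteredBy c k)
    halting⇒enteredBy {k} (f , eq , v , ev) =
      subst (λ e → Eventually (λ c → ConvergesBy c e k)) (trans (number≡encode f) eq) (convergesBy-complete ev)

    HaltsBy : ℕ → ℕ → Set
    HaltsBy c y = ConvergesBy c (number U) y

    haltsBy⇒halts : ∀ {c} ρ → HaltsBy c ⌜ ρ ⌝ → Halts U ρ
    haltsBy⇒halts ρ halts with convergesBy-sound halts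
    ... | f , eq , v , ev with number-injective f U eq
    ... | refl = decode v , ⇓-resp-≡ (sym (⌜decode⌝ v)) ev

    -- Light colours

    colours : ℕ → ℕ
    -- This is 4 ^ k, written as a power of two because the exponent is the number `r` of bits saved
    -- by a codeword.
    colours k = 2 ^ (2 * k)

    Class : ℕ → ℕ → ℕ → ℕ → Set
    Class c k j z = HaltsBy c z × colour (colours k) z ≡ j

    Light : ℕ → ℕ → ℕ → Set
    Light c k j = colours k * sum< c (weight c (Class c k j)) ≤ 2 ^ c

    FirstLight : ℕ → ℕ → ℕ → Set
    FirstLight c k j = j < colours k × Light c k j × (∀ i → i < j → ¬ Light c k i)

    -- Tests the colour of `z` itself, so the light colour never has to be computed; by
    -- `firstLight-unique` this is the class of that colour.
    LightClass : ℕ → ℕ → ℕ → Set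
    LightClass c k z = HaltsBy c z × FirstLight c k (colour (colours k) z)

    opaque
      firstLight-exists : ∀ c k → ∃ (FirstLight c k)
      firstLight-exists c k with light-colour c (colours k) (HaltsBy c) (colour (colours k)) (0<2^n (2 * k))
          (≤-trans (≤-reflexive (sum<-cong c (λ z _ → cong (_* 2 ^ (c ∸ len z)) (χ-cong
              (subst (HaltsBy c) (sym (⌜decode⌝ z))) (subst (HaltsBy c) (⌜decode⌝ z))))))
            (kraft c (λ ρ → HaltsBy c ⌜ ρ ⌝)
              (λ ρ σ a b → proj₁ U-universal ρ σ (haltsBy⇒halts ρ a) (haltsBy⇒halts (ρ ++ σ) b))))
      ... | j , j<m , light with least {Light c k} light
      ... | i , lightᵢ , first = i , ≤-<-trans (≮⇒≥ (λ j<i → first j j<i light)) j<m , lightᵢ , first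

    firstLight-unique : ∀ {c k i j} → FirstLight c k i → FirstLight c k j → i ≡ j
    firstLight-unique {i = i} {j} (_ , lᵢ , fᵢ) (_ , lⱼ , fⱼ) with <-cmp i j
    ... | tri< i<j _ _ = ⊥-elim (fⱼ i i<j lᵢ)
    ... | tri≈ _ i≡j _ = i≡j
    ... | tri> _ _ j<i = ⊥-elim (fᵢ j j<i lⱼ)

    lightClass-light : ∀ c k → colours k * sum< c (weight c (LightClass c k)) ≤ 2 ^ c
    lightClass-light c k = let j , fl = firstLight-exists c k in
      ≤-trans (≤-reflexive (cong (colours k *_) (sum<-cong c (λ z _ → cong (_* 2 ^ (c ∸ len z)) (χ-cong
        (λ { (h , fl′) → h , firstLight-unique {c} {k} fl′ fl })
        (λ { (h , eq) → h , subst (FirstLight c k) (sym eq) fl })))))) (proj₁ (proj₂ fl))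

    -- The compressing machine

    Describes : ℕ → ℕ → ℕ → ℕ → Set
    -- Insisting on the first stage makes `c` a function of `k`, so codewords that belong to the
    -- same `k` come from one and the same code.
    Describes k c y w = EnteredBy c k × (∀ d → d < c → ¬ EnteredBy d k) ×
      y < c × LightClass c k y × Codeword c (2 * k) (LightClass c k) y (decode w)

    describes-prefix : ∀ {k c c′ y y′ w w′} σ → Describes k c y w → Describes k c′ y′ w′ →
                       decode w ++ σ ≡ decode w′ → c ≡ c′ × y ≡ y′ × σ ≡ []
    describes-prefix {k} {c} {c′} {y} {y′} {w} σ (e , first , y<c , l , cw) (e′ , first′ , y′<c , l′ , cw′) eq
      with <-cmp c c′
    ... | tri< c<c′ _ _ = ⊥-elim (first′ c c<c′ e)
    ... | tri> _ _ c′<c = ⊥-elim (first c′ c′<c e′)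
    ... | tri≈ _ refl _ = refl , codeword-prefixFree {c} {2 * k} {LightClass c k} {y} {y′} {decode w} σ y<c y′<c l l′ cw
            (subst (Codeword c (2 * k) (LightClass c k) y′) (sym eq) cw′)

    -- The number of the part behind the unary prefix, read off from `⌜selfDelimited⌝`.
    rest : ℕ → ℕ
    rest x = pred (π₂ (2 + x))

    -- `n` packs `k`, `c` and `y`. The equation also excludes strings without a 0: there unpairing
    -- yields 0, which `pred` would conceal.
    Parses : ℕ → ℕ → Set
    Parses n x = 2 + x ≡ couple (π₁ n) (suc (rest x)) ×
      Describes (π₁ n) (π₁ (π₂ n)) (π₂ (π₂ n)) (rest x)

    parses⇒selfDelimited : ∀ {n} ρ → Parses n ⌜ ρ ⌝ → ρ ≡ selfDelimited (π₁ n) (decode (rest ⌜ ρ ⌝))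
    parses⇒selfDelimited {n} ρ (eq , _) = ⌜⌝-injective _ _ (+-cancelˡ-≡ 2 _ _ (trans eq
      (trans (cong (λ w → couple (π₁ n) (suc w)) (sym (⌜decode⌝ (rest ⌜ ρ ⌝)))) (sym (⌜selfDelimited⌝ (π₁ n) _)))))

    parses-prefix : ∀ {n n′} ρ σ → Parses n ⌜ ρ ⌝ → Parses n′ ⌜ ρ ++ σ ⌝ → π₂ (π₂ n) ≡ π₂ (π₂ n′) × σ ≡ []
    parses-prefix {n} {n′} ρ σ p p′ =
      let k≡ , w≡ = selfDelimited-++ (π₁ n) (π₁ n′) (decode (rest ⌜ ρ ⌝)) (decode (rest ⌜ ρ ++ σ ⌝)) σ
                      (trans (cong (_++ σ) (sym (parses⇒selfDelimited {n} ρ p))) (parses⇒selfDelimited {n′} (ρ ++ σ) p′))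
          _ , result = describes-prefix σ (subst (λ k → Describes k (π₁ (π₂ n)) (π₂ (π₂ n)) (rest ⌜ ρ ⌝)) k≡ (proj₂ p)) (proj₂ p′) w≡
      in result

    -- Decidability over any oracle, for the machine as well as for the procedure using S

    module _ {O : ℕ → Bool} where

      convergesByᶜ : ∀ {n c e x} → Comp O n c → Comp O n e → Comp O n x →
                     CP O n (λ v → ConvergesBy (c v) (e v) (x v))
      convergesByᶜ c e x = callᴾ body (c ∷ᵃ e ∷ᵃ x ∷ᵃ []ᵃ)
        where
        body : CP O 3 (λ { (c , e , x , _) → ConvergesBy c e x })
        body = ∃<ᶜ (var (# 0)) (∃<ᶜ (var (# 0))
          (factᶜ (var (# 1)) (const 0) (var (# 3)) (coupleᶜ (var (# 4)) (const 0)) (var (# 0))))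

      coloursᶜ : ∀ {n k} → Comp O n k → Comp O n (λ v → colours (k v))
      coloursᶜ k = 2^ᶜ (const 2 *ᶜ k)

      haltsByᶜ : ∀ {n c y} → Comp O n c → Comp O n y → CP O n (λ v → HaltsBy (c v) (y v))
      haltsByᶜ c y = convergesByᶜ c (const (number U)) y

      classColourᶜ : ∀ {n k y} → Comp O n k → Comp O n y → Comp O n (λ v → colour (colours (k v)) (y v))
      classColourᶜ k y = colourᶜ (liftᴾ matrixᶜ) (coloursᶜ k) y

      lightᶜ : CP O 3 (λ { (j , c , k , _) → Light c k j })
      lightᶜ = coloursᶜ (var (# 2)) *ᶜ sumᶜ (var (# 1)) (indicator
          (haltsByᶜ (var (# 2)) (var (# 0)) ×ᶜ classColourᶜ (var (# 3)) (var (# 0)) ≡ᶜ var (# 1))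
          *ᶜ 2^ᶜ (var (# 2) ∸ᶜ lenᶜ (var (# 0))))
        ≤ᶜ 2^ᶜ var (# 1)

      firstLightᶜ : CP O 3 (λ { (j , c , k , _) → FirstLight c k j })
      firstLightᶜ = var (# 0) <ᶜ coloursᶜ (var (# 2)) ×ᶜ lightᶜ
        ×ᶜ ∀<ᶜ (var (# 0)) (¬ᶜ (callᴾ lightᶜ (var (# 0) ∷ᵃ var (# 2) ∷ᵃ var (# 3) ∷ᵃ []ᵃ)))

      lightClassᶜ : CP O 3 (λ { (z , c , k , _) → LightClass c k z })
      lightClassᶜ = haltsByᶜ (var (# 1)) (var (# 0))
        ×ᶜ callᴾ firstLightᶜ (classColourᶜ (var (# 2)) (var (# 0)) ∷ᵃ var (# 1) ∷ᵃ var (# 2) ∷ᵃ []ᵃ)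

      describesᶜ : CP O 4 (λ { (k , c , y , w , _) → Describes k c y w })
      describesᶜ =
        convergesByᶜ c k k
        ×ᶜ ∀<ᶜ c (¬ᶜ (convergesByᶜ (var (# 0)) (var (# 1)) (var (# 1))))
        ×ᶜ y <ᶜ c
        ×ᶜ callᴾ lightClassᶜ (y ∷ᵃ c ∷ᵃ k ∷ᵃ []ᵃ)
        ×ᶜ lenᶜ w +ᶜ const 2 *ᶜ k ≡ᶜ lenᶜ y
        ×ᶜ valᶜ w *ᶜ 2^ᶜ (c ∸ᶜ lenᶜ y) ≡ᶜ sumᶜ y
             (indicator (callᴾ lightClassᶜ (var (# 0) ∷ᵃ var (# 2) ∷ᵃ var (# 1) ∷ᵃ []ᵃ))
              *ᶜ 2^ᶜ (var (# 2) ∸ᶜ lenᶜ (var (# 0))))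
        where
        k = var {O} {4} (# 0)
        c = var {O} {4} (# 1)
        y = var {O} {4} (# 2)
        w = var {O} {4} (# 3)

      restᶜ : ∀ {n x} → Comp O n x → Comp O n (λ v → rest (x v))
      restᶜ x = predᶜ (π₂ᶜ (sucᶜ (sucᶜ x)))

      opaque
        parsesᶜ : CP O 2 (λ { (n , x , _) → Parses n x })
        parsesᶜ =
          sucᶜ (sucᶜ (var (# 1))) ≡ᶜ coupleᶜ (π₁ᶜ (var (# 0))) (sucᶜ (restᶜ (var (# 1))))
          ×ᶜ callᴾ describesᶜ (π₁ᶜ (var (# 0)) ∷ᵃ π₁ᶜ (π₂ᶜ (var (# 0))) ∷ᵃ π₂ᶜ (π₂ᶜ (var (# 0)))
               ∷ᵃ restᶜ (var (# 1)) ∷ᵃ []ᵃ)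

    opaque
      outputᶜ : Comp ∅O 1 (λ v → π₂ (π₂ (proj₁ v)))
      outputᶜ = π₂ᶜ (π₂ᶜ (var zero))

      -- The parse is sought with the empty oracle, and `U` is then run on the string `y` it names.
      -- A description of `y` thus becomes a description of the output of `U` on `y`.
      machine : Code
      machine = comp U (comp (code outputᶜ) (search {∅O} parsesᶜ ∷ []) ∷ [])

      machine-halts : ∀ ρ → Halts machine ρ → ∃ λ n → Parses n ⌜ ρ ⌝
      machine-halts ρ (τ , ev) = let n , found = nested-elim ev in n , search-sound {∅O} parsesᶜ (⌜ ρ ⌝ , tt) found

      machine-runs : ∀ {n τ} ρ → Parses n ⌜ ρ ⌝ → Runs U (decode (π₂ (π₂ n))) τ → Runs machine ρ τ
      machine-runs {n} {τ} ρ p run-U =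
        let i , p′ , first = least {λ i → Parses i ⌜ ρ ⌝} p
            -- The search returns the least parse, perhaps not `n`; with an empty extension,
            -- `parses-prefix` shows that both name the same string.
            y≡ = proj₁ (parses-prefix {n} {i} ρ [] p (subst (λ s → Parses i ⌜ s ⌝) (sym (++-identityʳ ρ)) p′))
        in nested-intro (search-finds {∅O} parsesᶜ (⌜ ρ ⌝ , tt) p′ first) (run outputᶜ (i , tt))
             (subst (λ y → ∅O ⊢ U [ y ∷ [] ]⇓ ⌜ τ ⌝) (trans (⌜decode⌝ _) y≡) run-U)

    -- Halting presupposes a parse, and parsable strings are already prefix-free, whatever `U` does
    -- afterwards.
    machine-prefixFree : PrefixFree machine
    machine-prefixFree ρ σ h h′ = let n , p = machine-halts ρ h ; n′ , p′ = machine-halts (ρ ++ σ) h′ in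
      proj₂ (parses-prefix {n} {n′} ρ σ p p′)

    -- The search for elements of S and the bound on late entries

    Found : ℕ → ℕ → Set
    Found s k = ∀ j → j < colours k → ∃ λ y → y < s × InS y × colour (colours k) y ≡ j × HaltsBy s y

    opaque
      eventually-found : ∀ k → Eventually (λ s → Found s k)
      eventually-found k = eventually-∀ {λ s j → ∃ λ y → y < s × Member s j y} (colours k)
        (λ j j<m → member j (every-colour-in-S (colours k) j j<m))
        where
        Member : ℕ → ℕ → ℕ → Set
        Member s j y = InS y × colour (colours k) y ≡ j × HaltsBy s y
        halts : ∀ y → InS y → Eventually (λ s → HaltsBy s y)
        halts y s = let τ , runs , _ = S⊆M_U (decode y) s in
          convergesBy-complete (subst (λ x → ∅O ⊢ U [ x ∷ [] ]⇓ ⌜ τ ⌝) (⌜decode⌝ y) runs)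
        member : ∀ j → (∃ λ y → InS y × colour (colours k) y ≡ j) →
                 Eventually (λ s → ∃ λ y → y < s × Member s j y)
        member j (y , s , eq) = eventually-∃ {λ s → Member s j} y
          (eventually-map (λ _ h → s , eq , h) (halts y s))

    opaque
      -- For the simulation prefix σ, minimality gives |w| + 2 k ≤ |σ| + (k + 1 + |w|), hence k ≤
      -- |σ| + 1.
      threshold : ℕ
      threshold = 2 + length (proj₁ (proj₂ U-universal machine machine-prefixFree))

      -- An element of S in the light class would get a description that is too short.
      described-bounded : ∀ k c y w → InS y → EnteredBy c k → (∀ d → d < c → ¬ EnteredBy d k) → y < c →
                          LightClass c k y → Codeword c (2 * k) (LightClass c k) y w → k < threshold
      described-bounded k c y w inS entered first y<c lc codeword =
        let τ , runs , _ , minimal = S⊆M_U (decode y) inS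
            σ , simulates = proj₂ U-universal machine machine-prefixFree
        in bound σ (proj₁ codeword) (minimal (σ ++ selfDelimited k w) (proj₂ (simulates (selfDelimited k w) τ)
             (machine-runs (selfDelimited k w) parses (subst (λ z → Runs U (decode z) τ) (sym y≡) runs))))
        where
        y≡ : π₂ (π₂ (couple k (couple c y))) ≡ y
        y≡ = trans (cong π₂ (π₂-couple k (couple c y))) (π₂-couple c y)
        parses : Parses (couple k (couple c y)) ⌜ selfDelimited k w ⌝
        parses rewrite ⌜selfDelimited⌝ k w | π₂-couple k (suc ⌜ w ⌝) | π₁-couple k (couple c y)
                     | π₂-couple k (couple c y) | π₁-couple c y | π₂-couple c y
                     = refl , entered , first , y<c , lc ,
                       subst (Codeword c (2 * k) (LightClass c k) y) (sym (decode-⌜⌝ w)) codeword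
        bound : ∀ σ {l} → length w + 2 * k ≡ l → l ≤ length (σ ++ selfDelimited k w) → k < 2 + length σ
        bound σ refl le = s≤s (+-cancelˡ-≤ (length w + k) _ _ (≤-trans (≤-reflexive (lemma₁ (length w) k))
          (≤-trans le (≤-reflexive (trans (length-++ σ) (trans (cong (length σ +_) (length-selfDelimited k w))
            (lemma₂ (length σ) k (length w))))))))
          where
          lemma₁ : ∀ a b → a + b + b ≡ a + 2 * b
          lemma₁ = solve-∀
          lemma₂ : ∀ a b d → a + suc (b + d) ≡ d + b + suc a
          lemma₂ = solve-∀

    -- The entry stage `c` lies beyond `s`, so the element found for the colour that is light at `c`
    -- has halted by `c` and belongs to the light class.
    late-entry-bounded : ∀ {s k} → Found s k → Halting k → ¬ EnteredBy s k → k < threshold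
    late-entry-bounded {s} {k} found halts ¬entered =
      entering (least {λ c → EnteredBy c k} (proj₂ (halting⇒enteredBy halts) _ ≤-refl))
      where
      described : ∀ c j y → EnteredBy c k → (∀ d → d < c → ¬ EnteredBy d k) → s < c → FirstLight c k j →
                  y < s × InS y × colour (colours k) y ≡ j × HaltsBy s y → k < threshold
      described c j y entered first s<c fl (y<s , inS , colour≡ , halts) = finish
        (codeword-exists {c} {2 * k} {LightClass c k} {y} y<c lc (lightClass-light c k))
        where
        y<c = <-trans y<s s<c
        lc : LightClass c k y
        lc = convergesBy-mono (<⇒≤ s<c) halts , subst (FirstLight c k) (sym colour≡) fl
        finish : ∃ (Codeword c (2 * k) (LightClass c k) y) → k < threshold
        finish (w , codeword) = described-bounded k c y w inS entered first y<c lc codeword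
      entering : (∃ λ c → EnteredBy c k × (∀ d → d < c → ¬ EnteredBy d k)) → k < threshold
      entering (c , entered , first) = lit (firstLight-exists c k)
        where
        lit : ∃ (FirstLight c k) → k < threshold
        lit (j , fl) = let y , member = found j (proj₁ fl) in
          described c j y entered first (≰⇒> (λ c≤s → ¬entered (convergesBy-mono c≤s entered))) fl member

    opaque
      foundAt-least : ∀ k → ∃ λ s → Found s k × (∀ r → r < s → ¬ Found r k)
      foundAt-least k = least {λ s → Found s k} (proj₂ (eventually-found k) _ ≤-refl)

    foundAt : ℕ → ℕ
    foundAt k = proj₁ (foundAt-least k)

    -- The decision procedure with oracle S

    O : ℕ → Bool
    O = SOracle S

    -- All oracle queries of the procedure are made here.
    inSᶜ : ∀ {n y} → Comp O n y → CP O n (λ v → InS (y v))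
    inSᶜ {y = y} c = iffᶜ (λ v → bit-true) (λ v → cong bit)
      (mkComp (comp orc (code c ∷ [])) (λ v → ev-comp (ea-∷ (run c v) ea-[]) ev-orc) ≡ᶜ const 1)
      where
      bit-true : ∀ {b} → bit b ≡ 1 → b ≡ true
      bit-true {true} _ = refl

    foundᶜ : CP O 2 (λ { (s , k , _) → Found s k })
    foundᶜ = ∀<ᶜ (coloursᶜ (var (# 1))) (∃<ᶜ (var (# 1))
      (inSᶜ (var (# 0)) ×ᶜ classColourᶜ (var (# 3)) (var (# 0)) ≡ᶜ var (# 1) ×ᶜ haltsByᶜ (var (# 2)) (var (# 0))))

    foundAtᶜ : Comp O 1 (λ v → foundAt (proj₁ v))
    foundAtᶜ = mkComp (search foundᶜ) (λ v → let _ , p , first = foundAt-least (proj₁ v) in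
      search-finds foundᶜ v p first)

    -- Hardwires finitely many values of `f`, which itself need not be computable.
    finiteᶜ : ∀ n (f : ℕ → ℕ) → Comp O 1 (λ v → sum< n (λ i → χ (proj₁ v ≡ i) * f i))
    finiteᶜ zero    f = const 0
    finiteᶜ (suc n) f = indicator (var zero ≡ᶜ const n) *ᶜ const (f n) +ᶜ finiteᶜ n f

    -- At most one summand is nonzero: the table answers below `threshold`, the search from there
    -- on.
    decision : ℕ → ℕ
    decision k = sum< threshold (λ i → χ (k ≡ i) * χ (Halting i)) + χ (threshold ≤ k × EnteredBy (foundAt k) k)

    decision≡ : ∀ k → decision k ≡ χ (Halting k)
    decision≡ k = by-cases (k < threshold)
      (λ k< → trans (cong₂ _+_
        (trans (sum<-single (λ i → χ (k ≡ i) * χ (Halting i)) k<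
                 (λ j _ j≢k → cong (_* χ (Halting j)) (χ-no (λ k≡j → j≢k (sym k≡j)))))
               (trans (cong (_* χ (Halting k)) (χ-yes {k ≡ k} refl)) (+-identityʳ _)))
        (χ-no (λ p → <⇒≱ k< (proj₁ p)))) (+-identityʳ _))
      (λ k≮ → trans (cong (_+ χ (threshold ≤ k × EnteredBy (foundAt k) k))
          (sum<-zero threshold (λ i i< → cong (_* χ (Halting i)) (χ-no (λ { refl → k≮ i< })))))
        (χ-cong (λ p → enteredBy⇒halting (proj₂ p))
          (λ halts → ≮⇒≥ k≮ , ¬¬-elim (λ ¬e → k≮ (late-entry-bounded (proj₁ (proj₂ (foundAt-least k))) halts ¬e)))))

    halting≤TS : Halting ≤T O
    halting≤TS = code decisionᶜ , λ k →
      (λ h → ⇓-resp-≡ (trans (decision≡ k) (χ-yes h)) (run decisionᶜ (k , tt))) ,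
      (λ ¬h → ⇓-resp-≡ (trans (decision≡ k) (χ-no ¬h)) (run decisionᶜ (k , tt)))
      where
      decisionᶜ : Comp O 1 (λ v → decision (proj₁ v))
      decisionᶜ = finiteᶜ threshold (λ i → χ (Halting i))
        +ᶜ indicator (const threshold ≤ᶜ var zero ×ᶜ convergesByᶜ foundAtᶜ (var zero) (var zero))

theorem1p6 : ExcludedMiddle 0ℓ → (U : Code) → UniversalPF U →
    (S : Str → Bool) → (∀ ρ → S ρ ≡ true → InMU U ρ) →
    Infinite S → Δ⁰₂ S → Halting ≤T SOracle S
theorem1p6 em U universal S S⊆M_U infinite ((R , R-total , S-definition) , _) =
  Classical.Reduction.halting≤TS em U universal S S⊆M_U infinite R R-total S-definition
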